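{- Let $p_{3,3}(n)$ be defined by $\sum_{n\ge0}p_{3,3}(n)q^n=\frac{1}{E_1^3E_3^3}$. Let $m(i,j)$ and $b(j,k)$ be the integer matrices defined below. Then for every positive integer $j$, $$\sum_{n=0}^{\infty}p_{3,3}\left(3^{j}n+\tfrac{3^{j}+1}{2}\right)q^{n}=\sum_{l=1}^{\infty}b(j,l)q^{l-1}\frac{E_{3}^{12l-3}}{E_{1}^{12l+3}}.$$
   Context: $E_j=(q^j;q^j)_\infty=\prod_{n\ge1}(1-q^{jn})$. The matrix $\{m(i,j)\}_{i,j\ge1}$ is defined by (with $m(i,j)=0$ for $i\le0$): $m(1,1)=9$, $m(2,1)=6$, $m(3,1)=1$, $m(i,1)=0$ for $i\ge4$, and for $j\ge2$, $m(i,j)=27m(i-1,j-1)+9m(i-2,j-1)+m(i-3,j-1)$. The matrix $\{b(j,k)\}_{j,k\ge1}$ is defined by $b(1,1)=9$, $b(1,k)=0$ for $k\ge2$, and $b(j+1,k)=\sum_{i\ge1}b(j,i)m(4i+1,i+k)$ for $j,k\ge1$ (a finite sum). -}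

module Defs where

open import Data.Nat using (ℕ; zero; suc; _+_; _*_; _∸_; _≤?_)
open import Data.Nat.Divisibility using (_∣?_)
open import Data.Integer as ℤ using (ℤ; +_; -_)
open import Relation.Nullary.Decidable using (does)
open import Data.Bool using (if_then_else_)

Series : Set
Series = ℕ → ℤ

Σ0 : ℕ → (ℕ → ℤ) → ℤ
Σ0 zero    f = f 0
Σ0 (suc n) f = Σ0 n f ℤ.+ f (suc n)

Σ1ℕ : ℕ → (ℕ → ℕ) → ℕ
Σ1ℕ zero    f = 0
Σ1ℕ (suc n) f = Σ1ℕ n f + f (suc n)

Σ1 : ℕ → (ℕ → ℤ) → ℤ
Σ1 zero    f = + 0
Σ1 (suc n) f = Σ1 n f ℤ.+ f (suc n)

_⊛_ : Series → Series → Series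
(f ⊛ g) n = Σ0 n (λ i → f i ℤ.* g (n ∸ i))

one : Series
one zero    = + 1
one (suc _) = + 0

pow : Series → ℕ → Series
pow f zero    = one
pow f (suc k) = f ⊛ pow f k

-- the series 1 - q^m   (used with m ≥ 1)
oneMinusQ : ℕ → Series
oneMinusQ m n with n
... | zero = + 1
... | suc _ = if does (n Data.Nat.≟ m) then - (+ 1) else + 0

-- the series 1/(1 - q^m) = Σ_{r≥0} q^{mr}   (used with m ≥ 1)
geomQ : ℕ → Series
geomQ m n = if does (m ∣? n) then + 1 else + 0

prodTo : ℕ → (ℕ → Series) → Series
prodTo zero    F = one
prodTo (suc N) F = prodTo N F ⊛ F (suc N)

-- E_j = ∏_{k≥1} (1 - q^{jk}); for j ≥ 1 the coefficient of q^n only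
-- depends on the factors with k ≤ n.
E : ℕ → Series
E j n = prodTo n (λ k → oneMinusQ (j * k)) n

-- 1/E_j = ∏_{k≥1} 1/(1 - q^{jk}), truncated likewise (j ≥ 1).
Einv : ℕ → Series
Einv j n = prodTo n (λ k → geomQ (j * k)) n

p33 : Series
p33 = pow (Einv 1) 3 ⊛ pow (Einv 3) 3

shiftQ : ℕ → Series → Series
shiftQ s f n = if does (s ≤? n) then f (n ∸ s) else + 0

-- the matrix m(i,j), 1-indexed; value 0 for i ≤ 0 (and for the unused j = 0)
mm : ℕ → ℕ → ℕ
mm zero _ = 0
mm (suc i) zero = 0
mm 1 1 = 9
mm 2 1 = 6
mm 3 1 = 1
mm (suc (suc (suc (suc _)))) 1 = 0
mm i (suc (suc j)) =
  27 * mm (i ∸ 1) (suc j) + 9 * mm (i ∸ 2) (suc j) + mm (i ∸ 3) (suc j)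

-- the matrix b(j,k), 1-indexed (value 0 at the unused index 0).
-- b(j+1,k) = Σ_{i≥1} b(j,i) m(4i+1,i+k); since m(a,c) = 0 whenever a > 3c,
-- the summand vanishes for i ≥ 3k, so the sum over 1 ≤ i ≤ 3k is the full sum.
bb : ℕ → ℕ → ℕ
bb zero _ = 0
bb _ zero = 0
bb 1 1 = 9
bb 1 (suc (suc _)) = 0
bb (suc (suc j)) (suc k) =
  Σ1ℕ (3 * suc k) (λ i → bb (suc j) i * mm (4 * i + 1) (i + suc k))

-- coefficient of q^n in Σ_{l≥1} b(j,l) q^{l-1} E_3^{12l-3} / E_1^{12l+3};
-- terms with l > n+1 have order > n and contribute 0.
rhs : ℕ → Series
rhs j n = Σ1 (suc n) (λ l →
  (+ bb j l) ℤ.* shiftQ (l ∸ 1) (pow (E 3) (12 * l ∸ 3) ⊛ pow (Einv 1) (12 * l + 3)) n)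

-- Let U_r f = Σ f(3n+r) qⁿ. Jacobi's identity E₁³ = Σ (-1)ᵏ (2k+1) q^{k(k+1)/2}
-- gives the 3-dissection E₁³ = P(q³) − 3q E₉³. Taking the product over the
-- substitutions q ↦ ωq (ω³ = 1) of both sides yields P³ − 27q E₃⁹ = E₁¹²/E₃³.
-- Hence ζ = q E₉³/E₁³ satisfies ζ³ = τ(q³)(1 + 9ζ + 27ζ²) with τ = q E₃¹²/E₁¹²,
-- so U₀(ζⁱ) obeys the recurrence of the matrix m and equals Σ_k m(i,k) τᵏ.
-- The l-th term of the right-hand side for j is, up to factors in q³, the power
-- ζ^{4l+1}; applying U₁ to it produces the terms for j+1 with the entries of b.
-- The case j = 1 is U₂ of the dissection of 1/E₁³.
module Submission where

open import Defs
open import Defs using () renaming (_⊛_ to infixl 7 _⊗_)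
open import Algebra.Bundles using (CommutativeRing)
open import Algebra.Structures using (IsCommutativeRing)
open import Algebra.Solver.Ring.AlmostCommutativeRing using (fromCommutativeRing; _-Raw-AlmostCommutative⟶_)
import Algebra.Solver.Ring
open import Data.Bool using (if_then_else_)
open import Data.Integer as ℤ using (ℤ; +_; 0ℤ; 1ℤ)
import Data.Integer.Properties as ℤ
open import Data.Integer.Tactic.RingSolver using () renaming (solve-∀ to ℤ-solve-∀)
open import Data.Maybe using (Maybe; just; nothing)
open import Data.Nat as ℕ using (ℕ; zero; suc; _∸_; _<_; z≤n; s≤s; _≤?_)
open import Data.Nat using (_+_; _*_; _^_; _/_; _≤_)
open import Data.Nat.Divisibility using (_∣_; _∣?_; ∣m+n∣m⇒∣n; ∣m∣n⇒∣m+n; ∣-refl; ∣⇒≤; _∣0)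
open import Data.Nat.DivMod using (m*n/n≡m)
import Data.Nat.Properties as ℕ
open import Data.Nat.Tactic.RingSolver using () renaming (solve-∀ to ℕ-solve-∀)
open import Data.Product using (_,_)
open import Function using (mk⇔)
open import Level using (0ℓ)
open import Relation.Nullary using (yes; no; does)
open import Relation.Nullary.Decidable using (dec-true; dec-false; does-⇔)
open import Relation.Binary.Bundles using (Setoid)
open import Relation.Binary.PropositionalEquality using (_≡_; refl; sym; trans; cong; cong₂; subst; module ≡-Reasoning)
open import Relation.Binary.Structures using (IsEquivalence)
import Relation.Binary.Reasoning.Setoid as SetoidReasoning

-- The ring of power series

-- Two obstacles shape the proof. An infinite product is given only through the finite product
-- attached to each coefficient; so every identity about `E` is obtained modulo q^N, for all N, from
-- an exact identity between finite products or sums. Jacobi's identity therefore starts from a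
-- finite triple product in an auxiliary variable z: its derivative at z = 1 yields the weights
-- 2k+1, and its coefficients tend to (-1)^k q^(k(k+1)/2) / E₁. Secondly, integer series contain no
-- ω; the product over q ↦ ωq is replaced by a cubic norm form in the three sections of a series,
-- whose multiplicativity is a polynomial identity. The recurrence for U₀(ζⁱ) needs three initial
-- values. Besides U₀(1) = 1 these are U₀(ζ) = 9τ and U₀(ζ²) = 6τ + 243τ², both read off an explicit
-- dissection of 1/E₁³, which exists because P(q³)³ - (3q E₉³)³ is divisible by P(q³) - 3q E₉³ =
-- E₁³. The coefficients of τ in U₀(ζ), U₀(ζ²), U₀(ζ³) are the entries 9, 6, 1 of the first column
-- of m.

infix 4 _≈_
-- A record rather than a bare pointwise equality, so that the two series stay inferable instead of
-- unfolding to their coefficients.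
record _≈_ (f g : Series) : Set where
  constructor pointwise
  field at : ∀ n → f n ≡ g n
open _≈_

infixl 6 _⊕_
infix 8 ⊝_

_⊕_ : Series → Series → Series
(f ⊕ g) n = f n ℤ.+ g n

⊝_ : Series → Series
(⊝ f) n = ℤ.- f n

const : ℤ → Series
const c zero    = c
const c (suc _) = 0ℤ

tail : Series → Series
tail f n = f (suc n)

Σ0-cong : ∀ n {f g : ℕ → ℤ} → (∀ i → i ≤ n → f i ≡ g i) → Σ0 n f ≡ Σ0 n g
Σ0-cong zero    h = h 0 z≤n
Σ0-cong (suc n) h = cong₂ ℤ._+_ (Σ0-cong n λ i i≤n → h i (ℕ.m≤n⇒m≤1+n i≤n)) (h (suc n) ℕ.≤-refl)

Σ0-head : ∀ n (f : ℕ → ℤ) → Σ0 (suc n) f ≡ f 0 ℤ.+ Σ0 n (λ i → f (suc i))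
Σ0-head zero    f = refl
Σ0-head (suc n) f = trans (cong (ℤ._+ f (suc (suc n))) (Σ0-head n f)) (ℤ.+-assoc (f 0) _ _)

-- Splitting off `f 0` lowers the index and leaves a product with `tail f`. The ring laws below are
-- inductions on the index with the series generalized.
⊛-suc : ∀ f g n → (f ⊛ g) (suc n) ≡ f 0 ℤ.* g (suc n) ℤ.+ (tail f ⊛ g) n
⊛-suc f g n = Σ0-head n _

⊛-cong≤ : ∀ n {f f′ g g′ : Series} → (∀ i → i ≤ n → f i ≡ f′ i) → (∀ i → i ≤ n → g i ≡ g′ i) →
          (f ⊛ g) n ≡ (f′ ⊛ g′) n
⊛-cong≤ n hf hg = Σ0-cong n λ i i≤n → cong₂ ℤ._*_ (hf i i≤n) (hg (n ∸ i) (ℕ.m∸n≤m n i))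

⊛-cong : ∀ {f f′ g g′} → f ≈ f′ → g ≈ g′ → f ⊛ g ≈ f′ ⊛ g′
⊛-cong p r = pointwise λ n → ⊛-cong≤ n (λ i _ → at p i) (λ i _ → at r i)

distribʳ-at : ∀ f g h n → ((f ⊕ g) ⊛ h) n ≡ (f ⊛ h) n ℤ.+ (g ⊛ h) n
distribʳ-at f g h zero    = ℤ.*-distribʳ-+ (h 0) (f 0) (g 0)
distribʳ-at f g h (suc n) = begin
  ((f ⊕ g) ⊛ h) (suc n)                                      ≡⟨ ⊛-suc (f ⊕ g) h n ⟩
  (f 0 ℤ.+ g 0) ℤ.* h (suc n) ℤ.+ ((tail f ⊕ tail g) ⊛ h) n  ≡⟨ cong (λ z → (f 0 ℤ.+ g 0) ℤ.* h (suc n) ℤ.+ z) (distribʳ-at (tail f) (tail g) h n) ⟩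
  _                                                          ≡⟨ shuffle (f 0) (g 0) (h (suc n)) _ _ ⟩
  _                                                          ≡⟨ cong₂ ℤ._+_ (⊛-suc f h n) (⊛-suc g h n) ⟨
  (f ⊛ h) (suc n) ℤ.+ (g ⊛ h) (suc n)                        ∎
  where
  open ≡-Reasoning
  shuffle : ∀ a b c x y → (a ℤ.+ b) ℤ.* c ℤ.+ (x ℤ.+ y) ≡ (a ℤ.* c ℤ.+ x) ℤ.+ (b ℤ.* c ℤ.+ y)
  shuffle = ℤ-solve-∀

-- `⊛-suc` is one-sided, so a term is split off each factor in turn; this lowers the index by two,
-- whence two base cases.
⊛-comm-at : ∀ f g n → (f ⊛ g) n ≡ (g ⊛ f) n
⊛-comm-at f g zero          = ℤ.*-comm (f 0) (g 0)
⊛-comm-at f g (suc zero)    = swap (f 0) (g 1) (f 1) (g 0)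
  where
  swap : ∀ a b c d → a ℤ.* b ℤ.+ c ℤ.* d ≡ d ℤ.* c ℤ.+ b ℤ.* a
  swap = ℤ-solve-∀
⊛-comm-at f g (suc (suc n)) = begin
  (f ⊛ g) (suc (suc n))                                    ≡⟨ ⊛-suc f g (suc n) ⟩
  a ℤ.+ (tail f ⊛ g) (suc n)                               ≡⟨ cong (ℤ._+_ a) (⊛-comm-at (tail f) g (suc n)) ⟩
  a ℤ.+ (g ⊛ tail f) (suc n)                               ≡⟨ cong (ℤ._+_ a) (⊛-suc g (tail f) n) ⟩
  a ℤ.+ (b ℤ.+ (tail g ⊛ tail f) n)                        ≡⟨ swap a b _ ⟩
  b ℤ.+ (a ℤ.+ (tail g ⊛ tail f) n)                        ≡⟨ cong (λ z → b ℤ.+ (a ℤ.+ z)) (⊛-comm-at (tail g) (tail f) n) ⟩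
  b ℤ.+ (a ℤ.+ (tail f ⊛ tail g) n)                        ≡⟨ cong (ℤ._+_ b) (⊛-suc f (tail g) n) ⟨
  b ℤ.+ (f ⊛ tail g) (suc n)                               ≡⟨ cong (ℤ._+_ b) (⊛-comm-at f (tail g) (suc n)) ⟩
  b ℤ.+ (tail g ⊛ f) (suc n)                               ≡⟨ ⊛-suc g f (suc n) ⟨
  (g ⊛ f) (suc (suc n))                                    ∎
  where
  open ≡-Reasoning
  a = f 0 ℤ.* g (suc (suc n))
  b = g 0 ℤ.* f (suc (suc n))
  swap : ∀ a b c → a ℤ.+ (b ℤ.+ c) ≡ b ℤ.+ (a ℤ.+ c)
  swap = ℤ-solve-∀

-- By `⊛-suc`, `tail (f ⊛ g)` is `scale (f 0) (tail g)` plus `tail f ⊛ g`; associativity rests on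
-- this.
scale : ℤ → Series → Series
scale c f n = c ℤ.* f n

scale-⊛ : ∀ c f g n → (scale c f ⊛ g) n ≡ c ℤ.* (f ⊛ g) n
scale-⊛ c f g zero    = ℤ.*-assoc c (f 0) (g 0)
scale-⊛ c f g (suc n) = begin
  (scale c f ⊛ g) (suc n)                                     ≡⟨ ⊛-suc (scale c f) g n ⟩
  c ℤ.* f 0 ℤ.* g (suc n) ℤ.+ (scale c (tail f) ⊛ g) n        ≡⟨ cong (λ z → c ℤ.* f 0 ℤ.* g (suc n) ℤ.+ z) (scale-⊛ c (tail f) g n) ⟩
  c ℤ.* f 0 ℤ.* g (suc n) ℤ.+ c ℤ.* (tail f ⊛ g) n            ≡⟨ factor c (f 0) (g (suc n)) _ ⟩
  c ℤ.* (f 0 ℤ.* g (suc n) ℤ.+ (tail f ⊛ g) n)                ≡⟨ cong (c ℤ.*_) (⊛-suc f g n) ⟨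
  c ℤ.* (f ⊛ g) (suc n)                                       ∎
  where
  open ≡-Reasoning
  factor : ∀ c a b d → c ℤ.* a ℤ.* b ℤ.+ c ℤ.* d ≡ c ℤ.* (a ℤ.* b ℤ.+ d)
  factor = ℤ-solve-∀

⊛-assoc-at : ∀ f g h n → ((f ⊛ g) ⊛ h) n ≡ (f ⊛ (g ⊛ h)) n
⊛-assoc-at f g h zero    = ℤ.*-assoc (f 0) (g 0) (h 0)
⊛-assoc-at f g h (suc n) = begin
  ((f ⊛ g) ⊛ h) (suc n)                                                  ≡⟨ ⊛-suc (f ⊛ g) h n ⟩
  a ℤ.+ (tail (f ⊛ g) ⊛ h) n                                             ≡⟨ cong (ℤ._+_ a) (⊛-cong≤ n {g = h} (λ i _ → ⊛-suc f g i) (λ _ _ → refl)) ⟩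
  a ℤ.+ ((scale (f 0) (tail g) ⊕ (tail f ⊛ g)) ⊛ h) n                    ≡⟨ cong (ℤ._+_ a) (distribʳ-at (scale (f 0) (tail g)) (tail f ⊛ g) h n) ⟩
  a ℤ.+ ((scale (f 0) (tail g) ⊛ h) n ℤ.+ ((tail f ⊛ g) ⊛ h) n)          ≡⟨ cong (ℤ._+_ a) (cong₂ ℤ._+_ (scale-⊛ (f 0) (tail g) h n) (⊛-assoc-at (tail f) g h n)) ⟩
  a ℤ.+ (f 0 ℤ.* (tail g ⊛ h) n ℤ.+ (tail f ⊛ (g ⊛ h)) n)                ≡⟨ factor (f 0) (g 0) (h (suc n)) _ _ ⟩
  f 0 ℤ.* (g 0 ℤ.* h (suc n) ℤ.+ (tail g ⊛ h) n) ℤ.+ (tail f ⊛ (g ⊛ h)) n ≡⟨ cong (λ z → f 0 ℤ.* z ℤ.+ (tail f ⊛ (g ⊛ h)) n) (⊛-suc g h n) ⟨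
  f 0 ℤ.* (g ⊛ h) (suc n) ℤ.+ (tail f ⊛ (g ⊛ h)) n                       ≡⟨ ⊛-suc f (g ⊛ h) n ⟨
  (f ⊛ (g ⊛ h)) (suc n)                                                  ∎
  where
  open ≡-Reasoning
  a = f 0 ℤ.* g 0 ℤ.* h (suc n)
  factor : ∀ x y z b c → x ℤ.* y ℤ.* z ℤ.+ (x ℤ.* b ℤ.+ c) ≡ x ℤ.* (y ℤ.* z ℤ.+ b) ℤ.+ c
  factor = ℤ-solve-∀

zero-⊛ : ∀ c {f} → (∀ n → f n ≡ 0ℤ) → ∀ n → (f ⊛ c) n ≡ 0ℤ
zero-⊛ c h zero    = cong (ℤ._* c 0) (h 0)
zero-⊛ c {f} h (suc n) = trans (⊛-suc f c n) (cong₂ (λ x y → x ℤ.* c (suc n) ℤ.+ y) (h 0) (zero-⊛ c (λ i → h (suc i)) n))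

const-⊛ : ∀ c f → const c ⊛ f ≈ scale c f
const-⊛ c f = pointwise λ where
  zero    → refl
  (suc n) → trans (⊛-suc (const c) f n)
              (trans (cong (λ z → c ℤ.* f (suc n) ℤ.+ z) (zero-⊛ f (λ _ → refl) n)) (ℤ.+-identityʳ _))

one≈const1 : one ≈ const 1ℤ
one≈const1 = pointwise λ { zero → refl ; (suc _) → refl }

⊛-identityˡ : ∀ f → one ⊛ f ≈ f
⊛-identityˡ f = pointwise λ n →
  trans (at (⊛-cong {g = f} one≈const1 (pointwise λ _ → refl)) n) (trans (at (const-⊛ 1ℤ f) n) (ℤ.*-identityˡ (f n)))

⊛-comm : ∀ f g → f ⊛ g ≈ g ⊛ f
⊛-comm f g = pointwise (⊛-comm-at f g)

isCommutativeRing : IsCommutativeRing _≈_ _⊕_ _⊛_ ⊝_ (const 0ℤ) one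
isCommutativeRing = record
  { isRing = record
    { +-isAbelianGroup = record
      { isGroup = record
        { isMonoid = record
          { isSemigroup = record
            { isMagma = record
              { isEquivalence = isEquivalence
              ; ∙-cong = λ p r → pointwise λ n → cong₂ ℤ._+_ (at p n) (at r n)
              }
            ; assoc = λ f g h → pointwise λ n → ℤ.+-assoc (f n) (g n) (h n)
            }
          ; identity = (λ f → pointwise λ n → trans (cong (ℤ._+ f n) (const0 n)) (ℤ.+-identityˡ (f n)))
                     , (λ f → pointwise λ n → trans (cong (ℤ._+_ (f n)) (const0 n)) (ℤ.+-identityʳ (f n)))
          }
        ; inverse = (λ f → pointwise λ n → trans (ℤ.+-inverseˡ (f n)) (sym (const0 n)))
                  , (λ f → pointwise λ n → trans (ℤ.+-inverseʳ (f n)) (sym (const0 n)))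
        ; ⁻¹-cong = λ p → pointwise λ n → cong ℤ.-_ (at p n)
        }
      ; comm = λ f g → pointwise λ n → ℤ.+-comm (f n) (g n)
      }
    ; *-cong = ⊛-cong
    ; *-assoc = λ f g h → pointwise (⊛-assoc-at f g h)
    ; *-identity = ⊛-identityˡ , λ f → ≈-trans (⊛-comm f one) (⊛-identityˡ f)
    ; distrib = (λ f g h → pointwise λ n → trans (⊛-comm-at f (g ⊕ h) n) (trans (distribʳ-at g h f n)
                                            (cong₂ ℤ._+_ (⊛-comm-at g f n) (⊛-comm-at h f n))))
              , (λ f g h → pointwise (distribʳ-at g h f))
    }
  ; *-comm = ⊛-comm
  }
  where
  const0 : ∀ n → const 0ℤ n ≡ 0ℤ
  const0 zero    = refl
  const0 (suc _) = refl
  ≈-trans : ∀ {f g h} → f ≈ g → g ≈ h → f ≈ h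
  ≈-trans p r = pointwise λ n → trans (at p n) (at r n)
  isEquivalence : IsEquivalence _≈_
  isEquivalence = record
    { refl  = pointwise λ _ → refl
    ; sym   = λ p → pointwise λ n → sym (at p n)
    ; trans = ≈-trans
    }

seriesRing : CommutativeRing 0ℓ 0ℓ
seriesRing = record { isCommutativeRing = isCommutativeRing }

open CommutativeRing seriesRing
  using (setoid; reflexive)
  renaming ( refl to ≈-refl; sym to ≈-sym; trans to ≈-trans
           ; +-cong to ⊕-cong; +-congˡ to ⊕-congˡ; +-congʳ to ⊕-congʳ
           ; *-congˡ to ⊛-congˡ; *-congʳ to ⊛-congʳ; -‿cong to ⊝-cong; *-assoc to ⊛-assoc
           ; *-identityʳ to ⊛-identityʳ; zeroʳ to ⊛-zeroʳ; zeroˡ to ⊛-zeroˡ )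

-- Lets the ring solver compute with integer coefficients. In solver terms `con 1ℤ` denotes
-- `const 1ℤ` and `x :^ 0` denotes `one`; these agree only up to `_≈_`, and both spellings occur
-- below.
constMorphism : CommutativeRing.rawRing ℤ.+-*-commutativeRing -Raw-AlmostCommutative⟶ fromCommutativeRing seriesRing
constMorphism = record
  { ⟦_⟧    = const
  ; +-homo = λ a b → pointwise λ { zero → refl ; (suc _) → refl }
  ; *-homo = λ a b → pointwise λ n → trans (scaled a b n) (sym (at (const-⊛ a (const b)) n))
  ; -‿homo = λ a → pointwise λ { zero → refl ; (suc _) → refl }
  ; 0-homo = ≈-refl
  ; 1-homo = ≈-sym one≈const1
  }
  where
  scaled : ∀ a b n → const (a ℤ.* b) n ≡ a ℤ.* const b n
  scaled a b zero    = refl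
  scaled a b (suc n) = sym (ℤ.*-zeroʳ a)

const≟ : ∀ a b → Maybe (const a ≈ const b)
const≟ a b with a ℤ.≟ b
... | yes refl = just ≈-refl
... | no  _    = nothing

open module SeriesSolver = Algebra.Solver.Ring (CommutativeRing.rawRing ℤ.+-*-commutativeRing)
  (fromCommutativeRing seriesRing) constMorphism const≟
  using (solve; _:=_; _:*_; _:+_; _:-_; :-_; con; _:^_)

-- Truncated congruences, Euler products and 3-dissection

module ≈-Reasoning = SetoidReasoning setoid

infix 4 _≈[_]_
record _≈[_]_ (f : Series) (N : ℕ) (g : Series) : Set where
  constructor below
  field at< : ∀ n → n < N → f n ≡ g n
open _≈[_]_

truncate : ∀ {N f g} → f ≈ g → f ≈[ N ] g
truncate p = below λ n _ → at p n

≈[]-all : ∀ {f g} → (∀ N → f ≈[ N ] g) → f ≈ g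
≈[]-all h = pointwise λ n → at< (h (suc n)) n ℕ.≤-refl

weaken : ∀ {M N f g} → M ≤ N → f ≈[ N ] g → f ≈[ M ] g
weaken M≤N h = below λ n n<M → at< h n (ℕ.≤-trans n<M M≤N)

≈[]-setoid : ℕ → Setoid _ _
≈[]-setoid N = record
  { Carrier = Series
  ; _≈_ = _≈[ N ]_
  ; isEquivalence = record
    { refl  = below λ _ _ → refl
    ; sym   = λ h → below λ n n<N → sym (at< h n n<N)
    ; trans = λ h k → below λ n n<N → trans (at< h n n<N) (at< k n n<N)
    }
  }

module ≈[]-Reasoning (N : ℕ) = SetoidReasoning (≈[]-setoid N)

module _ {N : ℕ} where
  open Setoid (≈[]-setoid N) public using () renaming (refl to ≈[]-refl; sym to ≈[]-sym; trans to ≈[]-trans)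

⊕-cong[] : ∀ {N f f′ g g′} → f ≈[ N ] f′ → g ≈[ N ] g′ → f ⊕ g ≈[ N ] f′ ⊕ g′
⊕-cong[] h k = below λ n n<N → cong₂ ℤ._+_ (at< h n n<N) (at< k n n<N)

⊝-cong[] : ∀ {N f f′} → f ≈[ N ] f′ → ⊝ f ≈[ N ] ⊝ f′
⊝-cong[] h = below λ n n<N → cong ℤ.-_ (at< h n n<N)

⊗-cong[] : ∀ {N f f′ g g′} → f ≈[ N ] f′ → g ≈[ N ] g′ → f ⊗ g ≈[ N ] f′ ⊗ g′
⊗-cong[] h k = below λ n n<N →
  ⊛-cong≤ n (λ i i≤n → at< h i (ℕ.≤-<-trans i≤n n<N)) (λ i i≤n → at< k i (ℕ.≤-<-trans i≤n n<N))

pow-cong[] : ∀ {N f g} k → f ≈[ N ] g → pow f k ≈[ N ] pow g k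
pow-cong[] zero    h = ≈[]-refl
pow-cong[] (suc k) h = ⊗-cong[] h (pow-cong[] k h)

pow-cong : ∀ {f g} k → f ≈ g → pow f k ≈ pow g k
pow-cong zero    h = ≈-refl
pow-cong (suc k) h = ⊛-cong h (pow-cong k h)

pow-+ : ∀ f j k → pow f (j ℕ.+ k) ≈ pow f j ⊗ pow f k
pow-+ f zero    k = ≈-sym (⊛-identityˡ (pow f k))
pow-+ f (suc j) k = ≈-trans (⊛-congˡ {f} (pow-+ f j k)) (≈-sym (⊛-assoc f (pow f j) (pow f k)))

pow-⊗ : ∀ f g k → pow (f ⊗ g) k ≈ pow f k ⊗ pow g k
pow-⊗ f g zero    = ≈-sym (⊛-identityˡ one)
pow-⊗ f g (suc k) = ≈-trans (⊛-congˡ {f ⊗ g} (pow-⊗ f g k))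
  (solve 4 (λ a b c d → a :* b :* (c :* d) := a :* c :* (b :* d)) ≈-refl f g (pow f k) (pow g k))

pow-one : ∀ k → pow one k ≈ one
pow-one zero    = ≈-refl
pow-one (suc k) = ≈-trans (⊛-identityˡ (pow one k)) (pow-one k)

pow-* : ∀ f j k → pow f (j ℕ.* k) ≈ pow (pow f k) j
pow-* f zero    k = ≈-refl
pow-* f (suc j) k = ≈-trans (pow-+ f k (j ℕ.* k)) (⊛-congˡ {pow f k} (pow-* f j k))

inverse-unique : ∀ {f g h} → f ⊗ g ≈ one → f ⊗ h ≈ one → g ≈ h
inverse-unique {f} {g} {h} fg fh = begin
  g             ≈⟨ ⊛-identityʳ g ⟨
  g ⊗ one       ≈⟨ ⊛-congˡ {g} fh ⟨
  g ⊗ (f ⊗ h)   ≈⟨ solve 3 (λ f g h → g :* (f :* h) := f :* g :* h) ≈-refl f g h ⟩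
  f ⊗ g ⊗ h     ≈⟨ ⊛-congʳ {h} fg ⟩
  one ⊗ h       ≈⟨ ⊛-identityˡ h ⟩
  h             ∎
  where open ≈-Reasoning

⊗-cancel-unit : ∀ {u u⁻¹ f g} → u⁻¹ ⊗ u ≈ one → u ⊗ f ≈ u ⊗ g → f ≈ g
⊗-cancel-unit {u} {u⁻¹} {f} {g} inv h = begin
  f               ≈⟨ ⊛-identityˡ f ⟨
  one ⊗ f         ≈⟨ ⊛-congʳ {f} inv ⟨
  u⁻¹ ⊗ u ⊗ f     ≈⟨ ⊛-assoc u⁻¹ u f ⟩
  u⁻¹ ⊗ (u ⊗ f)   ≈⟨ ⊛-congˡ {u⁻¹} h ⟩
  u⁻¹ ⊗ (u ⊗ g)   ≈⟨ ⊛-assoc u⁻¹ u g ⟨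
  u⁻¹ ⊗ u ⊗ g     ≈⟨ ⊛-congʳ {g} inv ⟩
  one ⊗ g         ≈⟨ ⊛-identityˡ g ⟩
  g               ∎
  where open ≈-Reasoning

X : Series
X zero    = 0ℤ
X (suc n) = one n

X-⊗-suc : ∀ f n → (X ⊗ f) (suc n) ≡ f n
X-⊗-suc f n = trans (⊛-suc X f n) (trans (cong (ℤ._+ (one ⊛ f) n) (ℤ.*-zeroˡ (f (suc n)))) (trans (ℤ.+-identityˡ _) (at (⊛-identityˡ f) n)))

X-cancel : ∀ {f g} → X ⊗ f ≈ X ⊗ g → f ≈ g
X-cancel {f} {g} h = pointwise λ n → trans (sym (X-⊗-suc f n)) (trans (at h (suc n)) (X-⊗-suc g n))

Xpow-cancel : ∀ k {f g} → pow X k ⊗ f ≈ pow X k ⊗ g → f ≈ g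
Xpow-cancel zero    {f} {g} h = ≈-trans (≈-sym (⊛-identityˡ f)) (≈-trans h (⊛-identityˡ g))
Xpow-cancel (suc k) {f} {g} h = Xpow-cancel k (X-cancel
  (≈-trans (≈-sym (⊛-assoc X (pow X k) f)) (≈-trans h (⊛-assoc X (pow X k) g))))

Xpow-⊗ : ∀ m f n → (pow X m ⊗ f) n ≡ shiftQ m f n
Xpow-⊗ zero    f n    = at (⊛-identityˡ f) n
Xpow-⊗ (suc m) f zero = refl
Xpow-⊗ (suc m) f (suc n) = begin
  (X ⊗ pow X m ⊗ f) (suc n)   ≡⟨ at (⊛-assoc X (pow X m) f) (suc n) ⟩
  (X ⊗ (pow X m ⊗ f)) (suc n) ≡⟨ X-⊗-suc (pow X m ⊗ f) n ⟩
  (pow X m ⊗ f) n             ≡⟨ Xpow-⊗ m f n ⟩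
  shiftQ m f n                ≡⟨ shift m n ⟩
  shiftQ (suc m) f (suc n)    ∎
  where
  open ≡-Reasoning
  shift : ∀ m n → shiftQ m f n ≡ shiftQ (suc m) f (suc n)
  shift zero    n = refl
  shift (suc m) n = refl

shiftQ-< : ∀ m f n → n < m → shiftQ m f n ≡ 0ℤ
shiftQ-< m f n n<m rewrite dec-false (m ≤? n) (ℕ.<⇒≱ n<m) = refl

shiftQ-≥ : ∀ m f n → m ≤ n → shiftQ m f n ≡ f (n ∸ m)
shiftQ-≥ m f n m≤n rewrite dec-true (m ≤? n) m≤n = refl

Xpow-vanishes : ∀ N m f → N ≤ m → pow X m ⊗ f ≈[ N ] const 0ℤ
Xpow-vanishes N m f N≤m = below λ n n<N →
  trans (Xpow-⊗ m f n) (trans (shiftQ-< m f n (ℕ.≤-trans n<N N≤m)) (sym (const0 n)))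
  where
  const0 : ∀ n → const 0ℤ n ≡ 0ℤ
  const0 zero    = refl
  const0 (suc _) = refl

1-X^ : ℕ → Series
1-X^ m = one ⊕ ⊝ pow X m

oneMinusQ≈ : ∀ m → oneMinusQ (suc m) ≈ 1-X^ (suc m)
oneMinusQ≈ m = pointwise λ
  { zero    → refl
  ; (suc n) → trans (coefficient n m) (sym (trans (ℤ.+-identityˡ _) (cong ℤ.-_ (X-⊗-suc (pow X m) n))))
  }
  where
  coefficient : ∀ n m → (if does (n ℕ.≟ m) then ℤ.- (+ 1) else + 0) ≡ ℤ.- pow X m n
  coefficient zero    zero    = refl
  coefficient zero    (suc m) = refl
  coefficient (suc n) zero    = refl
  coefficient (suc n) (suc m) = trans (coefficient n m) (cong ℤ.-_ (sym (X-⊗-suc (pow X m) n)))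

1-X^-near-one : ∀ m → 1-X^ m ≈[ m ] one
1-X^-near-one m = ≈[]-trans (⊕-cong[] {f = one} ≈[]-refl (⊝-cong[] (≈[]-trans (truncate (≈-sym (⊛-identityʳ (pow X m)))) (Xpow-vanishes m m one ℕ.≤-refl))))
  (truncate (solve 1 (λ o → o :- con 0ℤ := o) ≈-refl one))

-- Multiplication by q^M shifts the indicator of the multiples of M by M, so that only coefficient 0
-- survives in the difference.
geomQ-inverse : ∀ m → oneMinusQ (suc m) ⊗ geomQ (suc m) ≈ one
geomQ-inverse m = pointwise λ n → begin
  (oneMinusQ M ⊗ geomQ M) n                  ≡⟨ at (⊛-congʳ {geomQ M} (oneMinusQ≈ m)) n ⟩
  (1-X^ M ⊗ geomQ M) n                       ≡⟨ at (expand (geomQ M)) n ⟩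
  geomQ M n ℤ.+ ℤ.- (pow X M ⊗ geomQ M) n    ≡⟨ cong (λ z → geomQ M n ℤ.+ ℤ.- z) (Xpow-⊗ M (geomQ M) n) ⟩
  geomQ M n ℤ.+ ℤ.- shiftQ M (geomQ M) n     ≡⟨ telescope n ⟩
  one n                                      ∎
  where
  open ≡-Reasoning
  M = suc m
  expand : ∀ g → 1-X^ M ⊗ g ≈ g ⊕ ⊝ (pow X M ⊗ g)
  expand g = ≈-trans (⊛-congʳ {g} (⊕-congʳ one≈const1)) (solve 2 (λ x g → (con 1ℤ :- x) :* g := g :- x :* g) ≈-refl (pow X M) g)
  telescope : ∀ n → geomQ M n ℤ.+ ℤ.- shiftQ M (geomQ M) n ≡ one n
  telescope n with M ≤? n
  telescope zero    | _ rewrite dec-true (M ∣? 0) (M ∣0) = refl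
  telescope (suc n) | no M≰n rewrite dec-false (M ∣? suc n) (λ d → M≰n (∣⇒≤ d)) =
    cong (λ z → 0ℤ ℤ.+ ℤ.- z) (shiftQ-< M (geomQ M) (suc n) (ℕ.≰⇒> M≰n))
  telescope (suc n) | yes M≤n = trans (cong (λ z → geomQ M (suc n) ℤ.+ ℤ.- z) (shiftQ-≥ M (geomQ M) (suc n) M≤n))
    (trans (cong (λ b → (if b then + 1 else + 0) ℤ.+ ℤ.- geomQ M (n ∸ m)) same) (ℤ.+-inverseʳ (geomQ M (n ∸ m))))
    where
    split : M ℕ.+ (n ∸ m) ≡ suc n
    split = ℕ.m+[n∸m]≡n M≤n
    same : does (M ∣? suc n) ≡ does (M ∣? (n ∸ m))
    same = does-⇔ (mk⇔ (λ d → ∣m+n∣m⇒∣n (subst (M ∣_) (sym split) d) ∣-refl) (λ d → subst (M ∣_) split (∣m∣n⇒∣m+n ∣-refl d))) (M ∣? suc n) (M ∣? (n ∸ m))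

prodTo-cong : ∀ {F G : ℕ → Series} N → (∀ k → F (suc k) ≈ G (suc k)) → prodTo N F ≈ prodTo N G
prodTo-cong zero    h = ≈-refl
prodTo-cong (suc N) h = ⊛-cong (prodTo-cong N h) (h N)

prodTo-inverse : ∀ {F G : ℕ → Series} N → (∀ k → F (suc k) ⊗ G (suc k) ≈ one) → prodTo N F ⊗ prodTo N G ≈ one
prodTo-inverse zero    h = ⊛-identityˡ one
prodTo-inverse {F} {G} (suc N) h = begin
  prodTo N F ⊗ F (suc N) ⊗ (prodTo N G ⊗ G (suc N))
    ≈⟨ solve 4 (λ a b c d → a :* b :* (c :* d) := a :* c :* (b :* d)) ≈-refl (prodTo N F) (F (suc N)) (prodTo N G) (G (suc N)) ⟩
  prodTo N F ⊗ prodTo N G ⊗ (F (suc N) ⊗ G (suc N)) ≈⟨ ⊛-cong (prodTo-inverse {F} {G} N h) (h N) ⟩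
  one ⊗ one                                         ≈⟨ ⊛-identityˡ one ⟩
  one                                               ∎
  where open ≈-Reasoning

prodTo-stable : ∀ {F : ℕ → Series} → (∀ k → F (suc k) ≈[ suc k ] one) → ∀ N d → prodTo (d ℕ.+ N) F ≈[ suc N ] prodTo N F
prodTo-stable h N zero = ≈[]-refl
prodTo-stable {F} h N (suc d) = begin
  prodTo (d ℕ.+ N) F ⊗ F (suc (d ℕ.+ N)) ≈⟨ ⊗-cong[] (prodTo-stable h N d) (weaken (s≤s (ℕ.m≤n+m N d)) (h (d ℕ.+ N))) ⟩
  prodTo N F ⊗ one                       ≈⟨ truncate (⊛-identityʳ (prodTo N F)) ⟩
  prodTo N F                             ∎
  where open ≈[]-Reasoning (suc N)

-- The left side is the diagonal form in which `E` and `Einv` are defined. Factors beyond the n-th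
-- do not touch coefficient n, so one finite product serves all coefficients up to N.
prodTo-limit : ∀ {F : ℕ → Series} → (∀ k → F (suc k) ≈[ suc k ] one) → ∀ N → (λ n → prodTo n F n) ≈[ suc N ] prodTo N F
prodTo-limit {F} h N = below λ { n (s≤s n≤N) →
  sym (trans (cong (λ k → prodTo k F n) (sym (ℕ.m∸n+n≡m n≤N))) (at< (prodTo-stable h n (N ∸ n)) n ℕ.≤-refl)) }

oneMinusQ-near-one : ∀ j k → oneMinusQ (suc j ℕ.* suc k) ≈[ suc k ] one
oneMinusQ-near-one j k = weaken (ℕ.m≤n*m (suc k) (suc j)) (≈[]-trans (truncate (oneMinusQ≈ _)) (1-X^-near-one _))

E-limit : ∀ j N → E (suc j) ≈[ suc N ] prodTo N (λ k → 1-X^ (suc j ℕ.* k))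
E-limit j N = ≈[]-trans (prodTo-limit (oneMinusQ-near-one j) N) (truncate (prodTo-cong N λ k → oneMinusQ≈ _))

geomQ-near-one : ∀ j k → geomQ (suc j ℕ.* suc k) ≈[ suc k ] one
geomQ-near-one j k = begin
  g                 ≈⟨ truncate (⊛-identityˡ g) ⟨
  one ⊗ g           ≈⟨ ⊗-cong[] {g = g} (oneMinusQ-near-one j k) ≈[]-refl ⟨
  oneMinusQ (suc j ℕ.* suc k) ⊗ g ≈⟨ truncate (geomQ-inverse _) ⟩
  one               ∎
  where
  open ≈[]-Reasoning (suc k)
  g = geomQ (suc j ℕ.* suc k)

E⊗Einv : ∀ j → E (suc j) ⊗ Einv (suc j) ≈ one
E⊗Einv j = ≈[]-all λ N → weaken (ℕ.n≤1+n N) (≈[]-trans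
  (⊗-cong[] (prodTo-limit (oneMinusQ-near-one j) N) (prodTo-limit (geomQ-near-one j) N))
  (truncate (prodTo-inverse {F = λ k → oneMinusQ (suc j ℕ.* k)} N (λ k → geomQ-inverse _))))

-- Sections modulo 3 and the substitution q ↦ q³

U : ℕ → Series → Series
U r f n = f (r ℕ.+ n ℕ.* 3)

-- The series f(q³). Its recursion in steps of three fits `n * 3` in `U`, which makes the rules
-- relating `U` and `V` plain inductions.
V : Series → Series
V f zero                = f 0
V f (suc zero)          = 0ℤ
V f (suc (suc zero))    = 0ℤ
V f (suc (suc (suc n))) = V (tail f) n

U-ext : ∀ {f g} → U 0 f ≈ U 0 g → U 1 f ≈ U 1 g → U 2 f ≈ U 2 g → f ≈ g
U-ext {f} {g} h₀ h₁ h₂ = pointwise (go f g h₀ h₁ h₂)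
  where
  go : ∀ f g → U 0 f ≈ U 0 g → U 1 f ≈ U 1 g → U 2 f ≈ U 2 g → ∀ n → f n ≡ g n
  go f g h₀ h₁ h₂ zero                = at h₀ 0
  go f g h₀ h₁ h₂ (suc zero)          = at h₁ 0
  go f g h₀ h₁ h₂ (suc (suc zero))    = at h₂ 0
  go f g h₀ h₁ h₂ (suc (suc (suc n))) = go (λ m → f (3 ℕ.+ m)) (λ m → g (3 ℕ.+ m))
    (pointwise λ m → at h₀ (suc m)) (pointwise λ m → at h₁ (suc m)) (pointwise λ m → at h₂ (suc m)) n

U-cong : ∀ r {f g} → f ≈ g → U r f ≈ U r g
U-cong r h = pointwise λ n → at h (r ℕ.+ n ℕ.* 3)

V-cong[] : ∀ {N f g} → f ≈[ N ] g → V f ≈[ N ℕ.* 3 ] V g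
V-cong[] h = below λ n → go n _ _ h
  where
  go : ∀ n {N} f g → f ≈[ N ] g → n < N ℕ.* 3 → V f n ≡ V g n
  go zero                {suc N} f g h _ = at< h 0 (s≤s z≤n)
  go (suc zero)          f g h _ = refl
  go (suc (suc zero))    f g h _ = refl
  go (suc (suc (suc n))) {suc N} f g h (s≤s (s≤s (s≤s n<))) = go n (tail f) (tail g) (below λ m m<N → at< h (suc m) (s≤s m<N)) n<

V-cong : ∀ {f g} → f ≈ g → V f ≈ V g
V-cong h = ≈[]-all λ N → weaken (ℕ.m≤m*n N 3) (V-cong[] {N} (truncate h))

-- A section divides the precision by 3, while `V` multiplies it by 3; hence the moduli q^(3N) in
-- what follows.
U-cong[] : ∀ {N f g} r → r < 3 → f ≈[ N ℕ.* 3 ] g → U r f ≈[ N ] U r g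
U-cong[] {N} r r<3 h = below λ n n<N → at< h (r ℕ.+ n ℕ.* 3)
  (ℕ.≤-trans (ℕ.+-monoˡ-< (n ℕ.* 3) r<3) (ℕ.*-monoˡ-≤ 3 n<N))

-- `⊛-suc` is applied three times; two of the coefficients of `V g` that are split off vanish.
V-⊗-at : ∀ g f m → (V g ⊗ f) (3 ℕ.+ m) ≡ g 0 ℤ.* f (3 ℕ.+ m) ℤ.+ (V (tail g) ⊗ f) m
V-⊗-at g f m = trans (⊛-suc (V g) f (2 ℕ.+ m)) (cong (λ z → g 0 ℤ.* f (3 ℕ.+ m) ℤ.+ z)
  (trans (skip (tail (V g)) refl (suc m)) (skip (tail (tail (V g))) refl m)))
  where
  skip : ∀ h → h 0 ≡ 0ℤ → ∀ n → (h ⊗ f) (suc n) ≡ (tail h ⊗ f) n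
  skip h h0 n = trans (⊛-suc h f n) (trans (cong (λ z → z ℤ.* f (suc n) ℤ.+ (tail h ⊗ f) n) h0)
    (trans (cong (ℤ._+ (tail h ⊗ f) n) (ℤ.*-zeroˡ (f (suc n)))) (ℤ.+-identityˡ _)))

U0-V⊗ : ∀ g f → U 0 (V g ⊗ f) ≈ g ⊗ U 0 f
U0-V⊗ g f = pointwise (go g)
  where
  go : ∀ g n → U 0 (V g ⊗ f) n ≡ (g ⊗ U 0 f) n
  go g zero    = refl
  go g (suc n) = trans (V-⊗-at g f (n ℕ.* 3)) (trans (cong (λ z → g 0 ℤ.* f (3 ℕ.+ n ℕ.* 3) ℤ.+ z) (go (tail g) n)) (sym (⊛-suc g (U 0 f) n)))

U1-V⊗ : ∀ g f → U 1 (V g ⊗ f) ≈ g ⊗ U 1 f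
U1-V⊗ g f = pointwise (go g)
  where
  go : ∀ g n → U 1 (V g ⊗ f) n ≡ (g ⊗ U 1 f) n
  go g zero    = trans (cong (λ z → g 0 ℤ.* f 1 ℤ.+ z) (ℤ.*-zeroˡ (f 0))) (ℤ.+-identityʳ _)
  go g (suc n) = trans (V-⊗-at g f (1 ℕ.+ n ℕ.* 3)) (trans (cong (λ z → g 0 ℤ.* f (4 ℕ.+ n ℕ.* 3) ℤ.+ z) (go (tail g) n)) (sym (⊛-suc g (U 1 f) n)))

U2-V⊗ : ∀ g f → U 2 (V g ⊗ f) ≈ g ⊗ U 2 f
U2-V⊗ g f = pointwise (go g)
  where
  go : ∀ g n → U 2 (V g ⊗ f) n ≡ (g ⊗ U 2 f) n
  go g zero    = trans (cong₂ (λ y z → g 0 ℤ.* f 2 ℤ.+ y ℤ.+ z) (ℤ.*-zeroˡ (f 1)) (ℤ.*-zeroˡ (f 0))) (trans (ℤ.+-identityʳ _) (ℤ.+-identityʳ _))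
  go g (suc n) = trans (V-⊗-at g f (2 ℕ.+ n ℕ.* 3)) (trans (cong (λ z → g 0 ℤ.* f (5 ℕ.+ n ℕ.* 3) ℤ.+ z) (go (tail g) n)) (sym (⊛-suc g (U 2 f) n)))

U0-V : ∀ f → U 0 (V f) ≈ f
U0-V f = pointwise (go f)
  where
  go : ∀ f n → U 0 (V f) n ≡ f n
  go f zero    = refl
  go f (suc n) = go (tail f) n

U1-V : ∀ f → U 1 (V f) ≈ const 0ℤ
U1-V f = pointwise (go f)
  where
  go : ∀ f n → U 1 (V f) n ≡ const 0ℤ n
  go f zero          = refl
  go f (suc zero)    = refl
  go f (suc (suc n)) = go (tail f) (suc n)

U2-V : ∀ f → U 2 (V f) ≈ const 0ℤ
U2-V f = pointwise (go f)
  where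
  go : ∀ f n → U 2 (V f) n ≡ const 0ℤ n
  go f zero          = refl
  go f (suc zero)    = refl
  go f (suc (suc n)) = go (tail f) (suc n)

U0-X⊗ : ∀ f → U 0 (X ⊗ f) ≈ X ⊗ U 2 f
U0-X⊗ f = pointwise λ where
  zero    → refl
  (suc n) → trans (X-⊗-suc f (2 ℕ.+ n ℕ.* 3)) (sym (X-⊗-suc (U 2 f) n))

U1-X⊗ : ∀ f → U 1 (X ⊗ f) ≈ U 0 f
U1-X⊗ f = pointwise λ n → X-⊗-suc f (n ℕ.* 3)

U2-X⊗ : ∀ f → U 2 (X ⊗ f) ≈ U 1 f
U2-X⊗ f = pointwise λ n → X-⊗-suc f (1 ℕ.+ n ℕ.* 3)

-- Both sides have the same three sections, so the convolutions need not be compared directly.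
V-⊗ : ∀ f g → V (f ⊗ g) ≈ V f ⊗ V g
V-⊗ f g = U-ext
  (≈-trans (U0-V (f ⊗ g)) (≈-sym (≈-trans (U0-V⊗ f (V g)) (⊛-congˡ {f} (U0-V g)))))
  (≈-trans (U1-V (f ⊗ g)) (≈-sym (≈-trans (U1-V⊗ f (V g)) (≈-trans (⊛-congˡ {f} (U1-V g)) (⊛-zeroʳ f)))))
  (≈-trans (U2-V (f ⊗ g)) (≈-sym (≈-trans (U2-V⊗ f (V g)) (≈-trans (⊛-congˡ {f} (U2-V g)) (⊛-zeroʳ f)))))

V-⊕ : ∀ f g → V (f ⊕ g) ≈ V f ⊕ V g
V-⊕ f g = pointwise (go f g)
  where
  go : ∀ f g n → V (f ⊕ g) n ≡ V f n ℤ.+ V g n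
  go f g zero                = refl
  go f g (suc zero)          = refl
  go f g (suc (suc zero))    = refl
  go f g (suc (suc (suc n))) = go (tail f) (tail g) n

V-⊝ : ∀ f → V (⊝ f) ≈ ⊝ V f
V-⊝ f = pointwise (go f)
  where
  go : ∀ f n → V (⊝ f) n ≡ ℤ.- V f n
  go f zero                = refl
  go f (suc zero)          = refl
  go f (suc (suc zero))    = refl
  go f (suc (suc (suc n))) = go (tail f) n

V-const : ∀ c → V (const c) ≈ const c
V-const c = pointwise λ
  { zero                → refl
  ; (suc zero)          → refl
  ; (suc (suc zero))    → refl
  ; (suc (suc (suc n))) → zeros _ (λ _ → refl) n
  }
  where
  zeros : ∀ f → (∀ n → f n ≡ 0ℤ) → ∀ n → V f n ≡ 0ℤ
  zeros f h zero                = h 0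
  zeros f h (suc zero)          = refl
  zeros f h (suc (suc zero))    = refl
  zeros f h (suc (suc (suc n))) = zeros (tail f) (λ m → h (suc m)) n

V-one : V one ≈ one
V-one = ≈-trans (V-cong one≈const1) (≈-trans (V-const 1ℤ) (≈-sym one≈const1))

V-pow : ∀ f k → V (pow f k) ≈ pow (V f) k
V-pow f zero    = V-one
V-pow f (suc k) = ≈-trans (V-⊗ f (pow f k)) (⊛-congˡ {V f} (V-pow f k))

V-X : V X ≈ pow X 3
V-X = U-ext
  (≈-trans (U0-V X) (≈-sym (≈-trans (U0-X⊗ (X ⊗ (X ⊗ one))) (≈-trans (⊛-congˡ {X} (≈-trans (U2-X⊗ (X ⊗ one)) (≈-trans (U1-X⊗ one) U0-one))) (⊛-identityʳ X)))))
  (≈-trans (U1-V X) (≈-sym (≈-trans (U1-X⊗ (X ⊗ (X ⊗ one))) (≈-trans (U0-X⊗ (X ⊗ one)) (≈-trans (⊛-congˡ {X} (≈-trans (U2-X⊗ one) U1-one)) (⊛-zeroʳ X))))))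
  (≈-trans (U2-V X) (≈-sym (≈-trans (U2-X⊗ (X ⊗ (X ⊗ one))) (≈-trans (U1-X⊗ (X ⊗ one)) (≈-trans (U0-X⊗ one) (≈-trans (⊛-congˡ {X} U2-one) (⊛-zeroʳ X)))))))
  where
  U0-one : U 0 one ≈ one
  U0-one = ≈-trans (U-cong 0 (≈-sym V-one)) (U0-V one)
  U1-one : U 1 one ≈ const 0ℤ
  U1-one = ≈-trans (U-cong 1 (≈-sym V-one)) (U1-V one)
  U2-one : U 2 one ≈ const 0ℤ
  U2-one = ≈-trans (U-cong 2 (≈-sym V-one)) (U2-V one)

V-Xpow : ∀ k → V (pow X k) ≈ pow X (3 ℕ.* k)
V-Xpow k = begin
  V (pow X k)       ≈⟨ V-pow X k ⟩
  pow (V X) k       ≈⟨ pow-cong k V-X ⟩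
  pow (pow X 3) k   ≈⟨ pow-* X k 3 ⟨
  pow X (k ℕ.* 3)   ≡⟨ cong (pow X) (ℕ.*-comm k 3) ⟩
  pow X (3 ℕ.* k)   ∎
  where open ≈-Reasoning

V-1-X^ : ∀ k → V (1-X^ k) ≈ 1-X^ (3 ℕ.* k)
V-1-X^ k = ≈-trans (V-⊕ one (⊝ pow X k)) (⊕-cong V-one (≈-trans (V-⊝ (pow X k)) (⊝-cong (V-Xpow k))))

V-prodTo : ∀ F N → V (prodTo N F) ≈ prodTo N (λ k → V (F k))
V-prodTo F zero    = V-one
V-prodTo F (suc N) = ≈-trans (V-⊗ (prodTo N F) (F (suc N))) (⊛-congʳ {V (F (suc N))} (V-prodTo F N))

-- The substitution is made factor by factor in the finite products, and the limit is taken
-- afterwards.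
V-E1 : V (E 1) ≈ E 3
V-E1 = ≈[]-all λ N → ≈[]-trans
  (weaken (ℕ.≤-trans (ℕ.n≤1+n N) (ℕ.m≤m*n (suc N) 3)) (V-cong[] (E-limit 0 N)))
  (≈[]-trans (truncate (≈-trans (V-prodTo _ N) (prodTo-cong N λ k → ≈-trans (V-1-X^ (1 ℕ.* suc k)) (reflexive
    (cong (λ z → 1-X^ (3 ℕ.* z)) (ℕ.*-identityˡ (suc k)))))))
  (weaken (ℕ.n≤1+n N) (≈[]-sym (E-limit 2 N))))

V-Einv1 : V (Einv 1) ≈ Einv 3
V-Einv1 = inverse-unique {E 3}
  (≈-trans (⊛-congʳ {V (Einv 1)} (≈-sym V-E1)) (≈-trans (≈-sym (V-⊗ (E 1) (Einv 1))) (≈-trans (V-cong (E⊗Einv 0)) V-one)))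
  (E⊗Einv 2)

-- Jacobi's identity

difference-zero : ∀ {f g} → f ≈ g → f ⊕ ⊝ g ≈ const 0ℤ
difference-zero {f} {g} h = ≈-trans (⊕-congʳ {⊝ g} h) (solve 1 (λ g → g :- g := con 0ℤ) ≈-refl g)

-- A certificate that an equation lies in the ideal generated by known ones: once the multipliers
-- are given, the last premise is a polynomial identity for the solver.
lincomb₂ : ∀ c₁ c₂ {l₁ r₁ l₂ r₂ lhs rhs} → l₁ ≈ r₁ → l₂ ≈ r₂ →
  lhs ⊕ ⊝ rhs ≈ c₁ ⊗ (l₁ ⊕ ⊝ r₁) ⊕ c₂ ⊗ (l₂ ⊕ ⊝ r₂) → lhs ≈ rhs
lincomb₂ c₁ c₂ {lhs = lhs} {rhs} h₁ h₂ h = begin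
  lhs                                 ≈⟨ solve 2 (λ l r → l := l :- r :+ r) ≈-refl lhs rhs ⟩
  lhs ⊕ ⊝ rhs ⊕ rhs                   ≈⟨ ⊕-congʳ {rhs} h ⟩
  _                                   ≈⟨ ⊕-congʳ {rhs} (⊕-cong (⊛-congˡ {c₁} (difference-zero h₁)) (⊛-congˡ {c₂} (difference-zero h₂))) ⟩
  c₁ ⊗ const 0ℤ ⊕ c₂ ⊗ const 0ℤ ⊕ rhs ≈⟨ solve 3 (λ a b r → a :* con 0ℤ :+ b :* con 0ℤ :+ r := r) ≈-refl c₁ c₂ rhs ⟩
  rhs                                 ∎
  where open ≈-Reasoning

lincomb₁ : ∀ c {l r lhs rhs} → l ≈ r → lhs ⊕ ⊝ rhs ≈ c ⊗ (l ⊕ ⊝ r) → lhs ≈ rhs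
lincomb₁ c {l} {r} {lhs} {rhs} h₁ h = lincomb₂ c c {l₂ = const 0ℤ} {const 0ℤ} h₁ ≈-refl
  (≈-trans h (solve 2 (λ c x → c :* x := c :* x :+ c :* (con 0ℤ :- con 0ℤ)) ≈-refl c (l ⊕ ⊝ r)))

lincomb₃ : ∀ c₁ c₂ c₃ {l₁ r₁ l₂ r₂ l₃ r₃ lhs rhs} → l₁ ≈ r₁ → l₂ ≈ r₂ → l₃ ≈ r₃ →
  lhs ⊕ ⊝ rhs ≈ c₁ ⊗ (l₁ ⊕ ⊝ r₁) ⊕ c₂ ⊗ (l₂ ⊕ ⊝ r₂) ⊕ c₃ ⊗ (l₃ ⊕ ⊝ r₃) → lhs ≈ rhs
lincomb₃ c₁ c₂ c₃ {l₁} {r₁} {l₂} {r₂} {l₃} {r₃} {lhs} {rhs} h₁ h₂ h₃ h = lincomb₂ c₁ c₂ h₁ h₂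
  (≈-trans h (≈-trans (⊕-congˡ {F} (≈-trans (⊛-congˡ {c₃} (difference-zero h₃)) (⊛-zeroʳ c₃))) (solve 1 (λ x → x :+ con 0ℤ := x) ≈-refl F)))
  where F = c₁ ⊗ (l₁ ⊕ ⊝ r₁) ⊕ c₂ ⊗ (l₂ ⊕ ⊝ r₂)

-- coeff n k is the coefficient of zᵏ in (1 − z⁻¹) ∏_{i ≤ n} (1 − z qⁱ)(1 − z⁻¹ qⁱ).
-- This is antisymmetric under k ↦ −1−k, whence the value of coeffPred n 0.
mutual
  coeff : ℕ → ℕ → Series
  coeff zero    zero    = one
  coeff zero    (suc k) = const 0ℤ
  coeff (suc n) k       = (const 1ℤ ⊕ pow X (suc n) ⊗ pow X (suc n)) ⊗ coeff n k
                          ⊕ ⊝ (pow X (suc n) ⊗ (coeffPred n k ⊕ coeff n (suc k)))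

  coeffPred : ℕ → ℕ → Series
  coeffPred n zero    = ⊝ coeff n 0
  coeffPred n (suc k) = coeff n k

-- The ratio of consecutive coefficients in (-1)^k q^(k(k+1)/2) times the q-binomial
-- [2n+1 over n-k], cleared of its denominator. It expresses how the product behaves under z ↦ qz,
-- but is derived here from the recursion in n.
coeff-suc : ∀ n k → coeff n (suc k) ⊗ (const 1ℤ ⊕ ⊝ (X ⊗ X ⊗ pow X n ⊗ pow X k))
                    ≈ ⊝ ((X ⊗ pow X k ⊕ ⊝ (X ⊗ pow X n)) ⊗ coeff n k)
coeff-suc zero zero = solve 2 (λ x y → con 0ℤ :* y := :- ((x :* x :^ 0 :- x :* x :^ 0) :* x :^ 0)) ≈-refl X (const 1ℤ ⊕ ⊝ (X ⊗ X ⊗ one ⊗ one))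
coeff-suc zero (suc k) = solve 3 (λ x y z → con 0ℤ :* y := :- (z :* con 0ℤ)) ≈-refl X (const 1ℤ ⊕ ⊝ (X ⊗ X ⊗ one ⊗ pow X (suc k))) (X ⊗ pow X (suc k) ⊕ ⊝ (X ⊗ one))
-- The claim for n + 1 involves the old coefficients from k - 1 to k + 2, hence three instances for
-- n: at k, k + 1 and k - 1.
coeff-suc (suc n) k = lincomb₃ (const 1ℤ ⊕ X ⊗ Q ⊗ Q) (⊝ Q) (⊝ (Q ⊗ X))
  (coeff-suc n k) (coeff-suc n (suc k)) (previous k)
  (solve 7 (λ x N K A B C D → let Q = x :* N in
    ((con 1ℤ :+ Q :* Q) :* C :- Q :* (B :+ D)) :* (con 1ℤ :- x :* x :* Q :* K)
      :- :- ((x :* K :- x :* Q) :* ((con 1ℤ :+ Q :* Q) :* B :- Q :* (A :+ C)))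
    := (con 1ℤ :+ x :* Q :* Q) :* (C :* (con 1ℤ :- x :* x :* N :* K) :- :- ((x :* K :- Q) :* B))
       :+ :- Q :* (D :* (con 1ℤ :- x :* x :* N :* (x :* K)) :- :- ((x :* (x :* K) :- Q) :* C))
       :+ :- (Q :* x) :* (B :* (con 1ℤ :- x :* N :* K) :- :- ((K :- Q) :* A)))
    ≈-refl X (pow X n) (pow X k) (coeffPred n k) (coeff n k) (coeff n (suc k)) (coeff n (suc (suc k))))
  where
  Q = pow X (suc n)
  previous : ∀ k → coeff n k ⊗ (const 1ℤ ⊕ ⊝ (X ⊗ pow X n ⊗ pow X k)) ≈ ⊝ ((pow X k ⊕ ⊝ (X ⊗ pow X n)) ⊗ coeffPred n k)
  -- The instance at -1 is automatic: by antisymmetry `coeffPred n 0` is the negative of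
  -- `coeff n 0`.
  previous zero    = solve 3 (λ x N B → B :* (con 1ℤ :- x :* N :* x :^ 0) := :- ((x :^ 0 :- x :* N) :* :- B)) ≈-refl X (pow X n) (coeff n 0)
  previous (suc k) = ≈-trans (⊛-congˡ {coeff n (suc k)} (solve 3 (λ x N K → con 1ℤ :- x :* N :* (x :* K) := con 1ℤ :- x :* x :* N :* K) ≈-refl X (pow X n) (pow X k))) (coeff-suc n k)

D : ℕ → Series
D N = prodTo N 1-X^

-- The starting value is the q-binomial [2n+1 over n], stated without division. In the induction,
-- `coeff-suc n 0` eliminates `coeff n 1`.
coeff-zero : ∀ n → coeff n 0 ⊗ D n ⊗ D (suc n) ≈ D (n ℕ.+ suc n)
coeff-zero zero = solve 2 (λ x y → x :^ 0 :* x :^ 0 :* y := y) ≈-refl X (D 1)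
coeff-zero (suc n) = begin
  coeff (suc n) 0 ⊗ (D n ⊗ 1-X^ (suc n)) ⊗ (D n ⊗ 1-X^ (suc n) ⊗ 1-X^ (suc (suc n)))
    ≈⟨ lincomb₂ (⊝ (Q ⊗ D n ⊗ D n ⊗ 1-X^ (suc n) ⊗ 1-X^ (suc n))) ((const 1ℤ ⊕ ⊝ (Q ⊗ Q)) ⊗ (const 1ℤ ⊕ ⊝ (X ⊗ Q ⊗ Q))) (coeff-suc n 0) (coeff-zero n)
        (solve 6 (λ x N B C d d′ → let Q = x :* N ; o = x :^ 0 in
          ((con 1ℤ :+ Q :* Q) :* B :- Q :* (:- B :+ C)) :* (d :* (o :- Q)) :* (d :* (o :- Q) :* (o :- x :* Q))
            :- d′ :* (con 1ℤ :- Q :* Q) :* (con 1ℤ :- x :* Q :* Q)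
          := :- (Q :* d :* d :* (o :- Q) :* (o :- Q)) :* (C :* (con 1ℤ :- x :* x :* N :* o) :- :- ((x :* o :- x :* N) :* B))
             :+ ((con 1ℤ :- Q :* Q) :* (con 1ℤ :- x :* Q :* Q)) :* (B :* d :* (d :* (o :- Q)) :- d′))
          ≈-refl X (pow X n) (coeff n 0) (coeff n 1) (D n) (D (n ℕ.+ suc n))) ⟩
  D (n ℕ.+ suc n) ⊗ (const 1ℤ ⊕ ⊝ (Q ⊗ Q)) ⊗ (const 1ℤ ⊕ ⊝ (X ⊗ Q ⊗ Q))
    ≈⟨ ⊛-cong (⊛-congˡ {D (n ℕ.+ suc n)} (⊕-cong (≈-sym one≈const1) (⊝-cong (≈-sym square)))) (⊕-cong (≈-sym one≈const1) (⊝-cong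
         (≈-trans (⊛-assoc X Q Q) (⊛-congˡ {X} (≈-sym square))))) ⟩
  D (suc (suc (n ℕ.+ suc n)))
    ≡⟨ cong (λ m → D (suc m)) (ℕ.+-suc n (suc n)) ⟨
  D (suc n ℕ.+ suc (suc n)) ∎
  where
  open ≈-Reasoning
  Q = pow X (suc n)
  square : pow X (suc (n ℕ.+ suc n)) ≈ Q ⊗ Q
  square = pow-+ X (suc n) (suc n)

sumTo : ℕ → (ℕ → Series) → Series
sumTo zero    F = const 0ℤ
sumTo (suc N) F = sumTo N F ⊕ F N

sumTo-cong : ∀ {F G : ℕ → Series} N → (∀ k → F k ≈ G k) → sumTo N F ≈ sumTo N G
sumTo-cong zero    h = ≈-refl
sumTo-cong (suc N) h = ⊕-cong (sumTo-cong N h) (h N)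

sumTo-cong[] : ∀ {F G : ℕ → Series} {M} N → (∀ k → F k ≈[ M ] G k) → sumTo N F ≈[ M ] sumTo N G
sumTo-cong[] zero    h = ≈[]-refl
sumTo-cong[] (suc N) h = ⊕-cong[] (sumTo-cong[] N h) (h N)

sumTo-⊗ : ∀ f F N → sumTo N F ⊗ f ≈ sumTo N (λ k → F k ⊗ f)
sumTo-⊗ f F zero    = ⊛-zeroˡ f
sumTo-⊗ f F (suc N) = ≈-trans (solve 3 (λ a b f → (a :+ b) :* f := a :* f :+ b :* f) ≈-refl (sumTo N F) (F N) f) (⊕-congʳ {F N ⊗ f} (sumTo-⊗ f F N))

-- The constant k as an iterated sum, so that the solver sees `nat (suc k)` as `nat k` plus 1.
nat : ℕ → Series
nat zero    = const 0ℤ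
nat (suc k) = nat k ⊕ const 1ℤ

odd : ℕ → Series
odd k = const (+ 2) ⊗ nat k ⊕ const 1ℤ

-- Summation by parts: the neighbours of k carry weights (2k+3) + (2k-1) = 2(2k+1), and only terms
-- at the boundary N remain. At k = 0 the weight 2k-1 = -1 is supplied by the antisymmetry in
-- `coeffPred`.
weighted-neighbours : ∀ n N →
  sumTo N (λ k → odd k ⊗ (coeffPred n k ⊕ coeff n (suc k))) ⊕ odd N ⊗ coeffPred n N
    ≈ const (+ 2) ⊗ sumTo N (λ k → odd k ⊗ coeff n k) ⊕ (const (+ 2) ⊗ nat N ⊕ ⊝ const 1ℤ) ⊗ coeff n N
weighted-neighbours n zero = solve 1 (λ b → con 0ℤ :+ (con (+ 2) :* con 0ℤ :+ con 1ℤ) :* :- b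
  := con (+ 2) :* con 0ℤ :+ (con (+ 2) :* con 0ℤ :- con 1ℤ) :* b) ≈-refl (coeff n 0)
weighted-neighbours n (suc N) = lincomb₁ (const 1ℤ) (weighted-neighbours n N)
  (solve 6 (λ S T ν A B C → let odd = con (+ 2) :* ν :+ con 1ℤ ; ν′ = ν :+ con 1ℤ in
     S :+ odd :* (A :+ C) :+ (con (+ 2) :* ν′ :+ con 1ℤ) :* B
       :- (con (+ 2) :* (T :+ odd :* B) :+ (con (+ 2) :* ν′ :- con 1ℤ) :* C)
     := con 1ℤ :* (S :+ odd :* A :- (con (+ 2) :* T :+ (con (+ 2) :* ν :- con 1ℤ) :* B)))
   ≈-refl (sumTo N (λ k → odd k ⊗ (coeffPred n k ⊕ coeff n (suc k)))) (sumTo N (λ k → odd k ⊗ coeff n k))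
   (nat N) (coeffPred n N) (coeff n N) (coeff n (suc N)))

coeff-vanishes : ∀ n k → n < k → coeff n k ≈ const 0ℤ
coeff-vanishes zero    (suc k) _ = ≈-refl
coeff-vanishes (suc n) (suc k) (s≤s n<k) = begin
  (const 1ℤ ⊕ Q ⊗ Q) ⊗ coeff n (suc k) ⊕ ⊝ (Q ⊗ (coeff n k ⊕ coeff n (suc (suc k))))
    ≈⟨ ⊕-cong (⊛-congˡ {const 1ℤ ⊕ Q ⊗ Q} (coeff-vanishes n (suc k) (ℕ.m<n⇒m<1+n n<k)))
         (⊝-cong (⊛-congˡ {Q} (⊕-cong (coeff-vanishes n k n<k) (coeff-vanishes n (suc (suc k)) (ℕ.m<n⇒m<1+n (ℕ.m<n⇒m<1+n n<k)))))) ⟩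
  (const 1ℤ ⊕ Q ⊗ Q) ⊗ const 0ℤ ⊕ ⊝ (Q ⊗ (const 0ℤ ⊕ const 0ℤ))
    ≈⟨ solve 1 (λ Q → (con 1ℤ :+ Q :* Q) :* con 0ℤ :- Q :* (con 0ℤ :+ con 0ℤ) := con 0ℤ) ≈-refl Q ⟩
  const 0ℤ ∎
  where
  open ≈-Reasoning
  Q = pow X (suc n)

-- This is the derivative at z = 1 of the product, where only 1 - z⁻¹ needs differentiating; pairing
-- k with -1-k gives the weight 2k+1. In the induction z is absent: by `weighted-neighbours` each
-- new factor contributes 1 + Q² - 2Q = (1 - Q)². The bound on N makes the boundary terms vanish.
weighted-sum : ∀ n N → suc (suc n) ≤ N → sumTo N (λ k → odd k ⊗ coeff n k) ≈ D n ⊗ D n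
weighted-sum zero (suc N) _ = ≈-trans (base N) (≈-sym (⊛-identityˡ one))
  where
  base : ∀ N → sumTo (suc N) (λ k → odd k ⊗ coeff 0 k) ≈ one
  base zero    = solve 1 (λ x → con 0ℤ :+ (con (+ 2) :* con 0ℤ :+ con 1ℤ) :* x :^ 0 := x :^ 0) ≈-refl X
  base (suc N) = ≈-trans (⊕-cong (base N) (⊛-zeroʳ (odd (suc N)))) (solve 1 (λ x → x :+ con 0ℤ := x) ≈-refl one)
weighted-sum (suc n) (suc N) (s≤s n<N) = begin
  sumTo (suc N) (λ k → odd k ⊗ coeff (suc n) k)
    ≈⟨ split (suc N) ⟩
  (const 1ℤ ⊕ Q ⊗ Q) ⊗ S ⊕ ⊝ (Q ⊗ S′)
    ≈⟨ lincomb₃ (⊝ Q) (Q ⊗ odd (suc N)) (⊝ (Q ⊗ (const (+ 2) ⊗ nat (suc N) ⊕ ⊝ const 1ℤ))) (weighted-neighbours n (suc N))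
         (coeff-vanishes n N n<N′) (coeff-vanishes n (suc N) (ℕ.m<n⇒m<1+n n<N′))
         (solve 6 (λ Q S S′ ν A B → let odd = con (+ 2) :* ν :+ con 1ℤ ; odd⁻ = con (+ 2) :* ν :- con 1ℤ in
           (con 1ℤ :+ Q :* Q) :* S :- Q :* S′ :- (Q :^ 0 :- Q) :* (Q :^ 0 :- Q) :* S
           := :- Q :* (S′ :+ odd :* A :- (con (+ 2) :* S :+ odd⁻ :* B)) :+ Q :* odd :* (A :- con 0ℤ) :+ :- (Q :* odd⁻) :* (B :- con 0ℤ))
         ≈-refl Q S S′ (nat (suc N)) (coeff n N) (coeff n (suc N))) ⟩
  1-X^ (suc n) ⊗ 1-X^ (suc n) ⊗ S
    ≈⟨ ⊛-congˡ {1-X^ (suc n) ⊗ 1-X^ (suc n)} (weighted-sum n (suc N) (ℕ.m≤n⇒m≤1+n n<N)) ⟩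
  1-X^ (suc n) ⊗ 1-X^ (suc n) ⊗ (D n ⊗ D n)
    ≈⟨ solve 2 (λ a d → a :* a :* (d :* d) := d :* a :* (d :* a)) ≈-refl (1-X^ (suc n)) (D n) ⟩
  D (suc n) ⊗ D (suc n) ∎
  where
  open ≈-Reasoning
  n<N′ : n < N
  n<N′ = ℕ.≤-trans (ℕ.n≤1+n (suc n)) n<N
  Q = pow X (suc n)
  S = sumTo (suc N) (λ k → odd k ⊗ coeff n k)
  S′ = sumTo (suc N) (λ k → odd k ⊗ (coeffPred n k ⊕ coeff n (suc k)))
  split : ∀ N → sumTo N (λ k → odd k ⊗ coeff (suc n) k)
    ≈ (const 1ℤ ⊕ Q ⊗ Q) ⊗ sumTo N (λ k → odd k ⊗ coeff n k) ⊕ ⊝ (Q ⊗ sumTo N (λ k → odd k ⊗ (coeffPred n k ⊕ coeff n (suc k))))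
  split zero    = solve 1 (λ Q → con 0ℤ := (con 1ℤ :+ Q :* Q) :* con 0ℤ :- Q :* con 0ℤ) ≈-refl Q
  split (suc N) = ≈-trans (⊕-congʳ {odd N ⊗ coeff (suc n) N} (split N)) (solve 6 (λ Q S S′ w B A → (con 1ℤ :+ Q :* Q) :* S :- Q :* S′ :+ w :* ((con 1ℤ :+ Q :* Q) :* B :- Q :* A)
    := (con 1ℤ :+ Q :* Q) :* (S :+ w :* B) :- Q :* (S′ :+ w :* A)) ≈-refl Q (sumTo N (λ k → odd k ⊗ coeff n k)) (sumTo N (λ k → odd k ⊗ (coeffPred n k ⊕ coeff n (suc k)))) (odd N) (coeff n N) (coeffPred n N ⊕ coeff n (suc N)))

E1-limit : ∀ N → E 1 ≈[ suc N ] D N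
E1-limit N = ≈[]-trans (E-limit 0 N) (truncate (prodTo-cong N λ k →
  reflexive (cong 1-X^ (ℕ.*-identityˡ (suc k)))))

triangular : ℕ → Series
triangular zero    = one
triangular (suc k) = ⊝ (pow X (suc k) ⊗ triangular k)

theta : ℕ → Series
theta N = sumTo N (λ k → odd k ⊗ triangular k)

coeff-limit : ∀ n k → coeff n k ⊗ E 1 ≈[ suc n ] triangular k
coeff-limit n zero = begin
  c ⊗ e                      ≈⟨ truncate (⊛-identityʳ (c ⊗ e)) ⟨
  c ⊗ e ⊗ one                ≈⟨ truncate (⊛-congˡ {c ⊗ e} (E⊗Einv 0)) ⟨
  c ⊗ e ⊗ (e ⊗ Einv 1)       ≈⟨ truncate (⊛-assoc (c ⊗ e) e (Einv 1)) ⟨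
  c ⊗ e ⊗ e ⊗ Einv 1         ≈⟨ ⊗-cong[] {g = Einv 1} squares ≈[]-refl ⟩
  e ⊗ Einv 1                 ≈⟨ truncate (E⊗Einv 0) ⟩
  one                        ∎
  where
  open ≈[]-Reasoning (suc n)
  c = coeff n 0
  e = E 1
  squares : c ⊗ e ⊗ e ≈[ suc n ] e
  squares = begin
    c ⊗ e ⊗ e             ≈⟨ ⊗-cong[] (⊗-cong[] {f = c} ≈[]-refl (E1-limit n)) (weaken (ℕ.n≤1+n (suc n)) (E1-limit (suc n))) ⟩
    c ⊗ D n ⊗ D (suc n)   ≈⟨ truncate (coeff-zero n) ⟩
    D (n ℕ.+ suc n)       ≈⟨ weaken (s≤s (ℕ.m≤m+n n (suc n))) (E1-limit (n ℕ.+ suc n)) ⟨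
    e                     ∎
coeff-limit n (suc k) = begin
  coeff n (suc k) ⊗ E 1                                                                  ≈⟨ ⊗-cong[] {g = E 1} step ≈[]-refl ⟩
  ⊝ (X ⊗ pow X k ⊗ coeff n k) ⊗ E 1                                                      ≈⟨ truncate (solve 3 (λ K c e → :- (K :* c) :* e := :- (K :* (c :* e))) ≈-refl (pow X (suc k)) (coeff n k) (E 1)) ⟩
  ⊝ (X ⊗ pow X k ⊗ (coeff n k ⊗ E 1))                                                    ≈⟨ ⊝-cong[] (⊗-cong[] {f = pow X (suc k)} ≈[]-refl (coeff-limit n k)) ⟩
  triangular (suc k) ∎
  where
  open ≈[]-Reasoning (suc n)
  vanish : ∀ f → pow X (suc n) ⊗ f ≈[ suc n ] const 0ℤ
  vanish f = Xpow-vanishes (suc n) (suc n) f ℕ.≤-refl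
  step : coeff n (suc k) ≈[ suc n ] ⊝ (X ⊗ pow X k ⊗ coeff n k)
  step = begin
    coeff n (suc k)
      ≈⟨ truncate (lincomb₁ (const 1ℤ) (coeff-suc n k) (solve 5 (λ x N K B C →
           C :- (:- (x :* K :* B) :+ (x :* N :* (B :+ x :* K :* C)))
           := con 1ℤ :* (C :* (con 1ℤ :- x :* x :* N :* K) :- :- ((x :* K :- x :* N) :* B))) ≈-refl X (pow X n) (pow X k) (coeff n k) (coeff n (suc k)))) ⟩
    ⊝ (X ⊗ pow X k ⊗ coeff n k) ⊕ pow X (suc n) ⊗ (coeff n k ⊕ X ⊗ pow X k ⊗ coeff n (suc k))
      ≈⟨ ⊕-cong[] {f = ⊝ (X ⊗ pow X k ⊗ coeff n k)} ≈[]-refl (vanish (coeff n k ⊕ X ⊗ pow X k ⊗ coeff n (suc k))) ⟩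
    ⊝ (X ⊗ pow X k ⊗ coeff n k) ⊕ const 0ℤ
      ≈⟨ truncate (solve 1 (λ x → x :+ con 0ℤ := x) ≈-refl (⊝ (X ⊗ pow X k ⊗ coeff n k))) ⟩
    ⊝ (X ⊗ pow X k ⊗ coeff n k) ∎

-- Two of the factors E₁ become the weighted sum of coefficients; the third turns each coefficient
-- into a signed power of q.
jacobi : ∀ n N → suc (suc n) ≤ N → pow (E 1) 3 ≈[ suc n ] theta N
jacobi n N n<N = begin
  E 1 ⊗ (E 1 ⊗ (E 1 ⊗ one))                           ≈⟨ truncate (solve 1 (λ e → e :^ 3 := e :* e :* e) ≈-refl (E 1)) ⟩
  E 1 ⊗ E 1 ⊗ E 1                                     ≈⟨ ⊗-cong[] {g = E 1} (⊗-cong[] (E1-limit n) (E1-limit n)) ≈[]-refl ⟩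
  D n ⊗ D n ⊗ E 1                                     ≈⟨ truncate (⊛-congʳ {E 1} (weighted-sum n N n<N)) ⟨
  sumTo N (λ k → odd k ⊗ coeff n k) ⊗ E 1             ≈⟨ truncate (sumTo-⊗ (E 1) _ N) ⟩
  sumTo N (λ k → odd k ⊗ coeff n k ⊗ E 1)             ≈⟨ sumTo-cong[] N (λ k → ≈[]-trans (truncate (⊛-assoc (odd k) (coeff n k) (E 1)))
                                                          (⊗-cong[] {f = odd k} ≈[]-refl (coeff-limit n k))) ⟩
  theta N                                             ∎
  where open ≈[]-Reasoning (suc n)

-- The 3-dissection of E₁³

assemble : Series → Series → Series → Series
assemble a b c = V a ⊕ X ⊗ V b ⊕ X ⊗ (X ⊗ V c)

U0-assemble : ∀ a b c → U 0 (assemble a b c) ≈ a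
U0-assemble a b c = begin
  U 0 (V a) ⊕ U 0 (X ⊗ V b) ⊕ U 0 (X ⊗ (X ⊗ V c))
    ≈⟨ ⊕-cong (⊕-cong (U0-V a) (≈-trans (U0-X⊗ (V b)) (⊛-congˡ {X} (U2-V b))))
              (≈-trans (U0-X⊗ (X ⊗ V c)) (⊛-congˡ {X} (≈-trans (U2-X⊗ (V c)) (U1-V c)))) ⟩
  a ⊕ X ⊗ const 0ℤ ⊕ X ⊗ const 0ℤ
    ≈⟨ solve 2 (λ a x → a :+ x :* con 0ℤ :+ x :* con 0ℤ := a) ≈-refl a X ⟩
  a ∎
  where open ≈-Reasoning

U1-assemble : ∀ a b c → U 1 (assemble a b c) ≈ b
U1-assemble a b c = begin
  U 1 (V a) ⊕ U 1 (X ⊗ V b) ⊕ U 1 (X ⊗ (X ⊗ V c))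
    ≈⟨ ⊕-cong (⊕-cong (U1-V a) (≈-trans (U1-X⊗ (V b)) (U0-V b)))
              (≈-trans (U1-X⊗ (X ⊗ V c)) (≈-trans (U0-X⊗ (V c)) (⊛-congˡ {X} (U2-V c)))) ⟩
  const 0ℤ ⊕ b ⊕ X ⊗ const 0ℤ
    ≈⟨ solve 2 (λ b x → con 0ℤ :+ b :+ x :* con 0ℤ := b) ≈-refl b X ⟩
  b ∎
  where open ≈-Reasoning

U2-assemble : ∀ a b c → U 2 (assemble a b c) ≈ c
U2-assemble a b c = begin
  U 2 (V a) ⊕ U 2 (X ⊗ V b) ⊕ U 2 (X ⊗ (X ⊗ V c))
    ≈⟨ ⊕-cong (⊕-cong (U2-V a) (≈-trans (U2-X⊗ (V b)) (U1-V b)))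
              (≈-trans (U2-X⊗ (X ⊗ V c)) (≈-trans (U1-X⊗ (V c)) (U0-V c))) ⟩
  const 0ℤ ⊕ const 0ℤ ⊕ c
    ≈⟨ solve 1 (λ c → con 0ℤ :+ con 0ℤ :+ c := c) ≈-refl c ⟩
  c ∎
  where open ≈-Reasoning

assemble-U : ∀ f → f ≈ assemble (U 0 f) (U 1 f) (U 2 f)
assemble-U f = U-ext (≈-sym (U0-assemble _ _ (U 2 f))) (≈-sym (U1-assemble (U 0 f) _ (U 2 f))) (≈-sym (U2-assemble (U 0 f) (U 1 f) _))

assemble-cong : ∀ {a a′ b b′ c c′} → a ≈ a′ → b ≈ b′ → c ≈ c′ → assemble a b c ≈ assemble a′ b′ c′
assemble-cong h₀ h₁ h₂ = ⊕-cong (⊕-cong (V-cong h₀) (⊛-congˡ {X} (V-cong h₁))) (⊛-congˡ {X} (⊛-congˡ {X} (V-cong h₂)))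

V-nat : ∀ k → V (nat k) ≈ nat k
V-nat zero    = V-const 0ℤ
V-nat (suc k) = ≈-trans (V-⊕ (nat k) (const 1ℤ)) (⊕-cong (V-nat k) (V-const 1ℤ))

V-odd : ∀ k → V (odd k) ≈ odd k
V-odd k = ≈-trans (V-⊕ (const (+ 2) ⊗ nat k) (const 1ℤ)) (⊕-cong (≈-trans (V-⊗ (const (+ 2)) (nat k)) (⊛-cong (V-const (+ 2)) (V-nat k))) (V-const 1ℤ))

nat-*3 : ∀ m → nat (m ℕ.* 3) ≈ const (+ 3) ⊗ nat m
nat-*3 zero    = solve 0 (con 0ℤ := con (+ 3) :* con 0ℤ) ≈-refl
nat-*3 (suc m) = lincomb₁ (const 1ℤ) (nat-*3 m)
  (solve 2 (λ a b → a :+ con 1ℤ :+ con 1ℤ :+ con 1ℤ :- con (+ 3) :* (b :+ con 1ℤ) := con 1ℤ :* (a :- con (+ 3) :* b)) ≈-refl (nat (m ℕ.* 3)) (nat m))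

-- (−1)ᵐ q^{m(3m+1)/2}, just as triangular k is (−1)ᵏ q^{k(k+1)/2}.
rootTriangular : ℕ → Series
rootTriangular zero    = one
rootTriangular (suc m) = ⊝ (pow X (suc m) ⊗ X ⊗ pow X m ⊗ pow X m ⊗ rootTriangular m)

Xpow-*3 : ∀ m → pow X (m ℕ.* 3) ≈ V (pow X m)
Xpow-*3 m = ≈-trans (reflexive (cong (pow X) (ℕ.*-comm m 3))) (≈-sym (V-Xpow m))

triangular-*3 : ∀ m → triangular (m ℕ.* 3) ≈ V (rootTriangular m)
triangular-*3 zero    = ≈-sym V-one
triangular-*3 (suc m) = begin
  ⊝ (X ⊗ (X ⊗ (X ⊗ Z)) ⊗ ⊝ (X ⊗ (X ⊗ Z) ⊗ ⊝ (X ⊗ Z ⊗ triangular (m ℕ.* 3))))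
    ≈⟨ ⊝-cong (⊛-cong (XXX Z) (⊝-cong (⊛-congˡ {X ⊗ (X ⊗ Z)} (⊝-cong (⊛-congˡ {X ⊗ Z} (triangular-*3 m)))))) ⟩
  ⊝ (V X ⊗ Z ⊗ ⊝ (X ⊗ (X ⊗ Z) ⊗ ⊝ (X ⊗ Z ⊗ V r)))
    ≈⟨ ⊝-cong (⊛-congˡ {V X ⊗ Z} (≈-trans (solve 3 (λ x Z r → :- (x :* (x :* Z) :* :- (x :* Z :* r)) := (x :* (x :* (x :* Z))) :* Z :* r) ≈-refl X Z (V r))
         (⊛-congʳ {V r} (⊛-congʳ {Z} (XXX Z))))) ⟩
  ⊝ (V X ⊗ Z ⊗ (V X ⊗ Z ⊗ Z ⊗ V r))
    ≈⟨ ⊝-cong (⊛-cong (⊛-congˡ {V X} (Xpow-*3 m)) (⊛-congʳ {V r} (⊛-cong (⊛-congˡ {V X} (Xpow-*3 m)) (Xpow-*3 m)))) ⟩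
  ⊝ (V X ⊗ V Y ⊗ (V X ⊗ V Y ⊗ V Y ⊗ V r))
    ≈⟨ ⊝-cong (solve 3 (λ x y r → x :* y :* (x :* y :* y :* r) := x :* y :* x :* y :* y :* r) ≈-refl (V X) (V Y) (V r)) ⟩
  ⊝ (V X ⊗ V Y ⊗ V X ⊗ V Y ⊗ V Y ⊗ V r)
    ≈⟨ ⊝-cong V-product ⟨
  ⊝ V (X ⊗ Y ⊗ X ⊗ Y ⊗ Y ⊗ r)
    ≈⟨ V-⊝ (X ⊗ Y ⊗ X ⊗ Y ⊗ Y ⊗ r) ⟨
  V (rootTriangular (suc m)) ∎
  where
  open ≈-Reasoning
  Z = pow X (m ℕ.* 3)
  Y = pow X m
  r = rootTriangular m
  XXX : ∀ f → X ⊗ (X ⊗ (X ⊗ f)) ≈ V X ⊗ f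
  XXX f = ≈-trans (solve 2 (λ x f → x :* (x :* (x :* f)) := x :^ 3 :* f) ≈-refl X f) (⊛-congʳ {f} (≈-sym V-X))
  V-product : V (X ⊗ Y ⊗ X ⊗ Y ⊗ Y ⊗ r) ≈ V X ⊗ V Y ⊗ V X ⊗ V Y ⊗ V Y ⊗ V r
  V-product = ≈-trans (V-⊗ (X ⊗ Y ⊗ X ⊗ Y ⊗ Y) r) (⊛-congʳ {V r} (≈-trans (V-⊗ (X ⊗ Y ⊗ X ⊗ Y) Y) (⊛-congʳ {V Y} (≈-trans (V-⊗ (X ⊗ Y ⊗ X) Y)
    (⊛-congʳ {V Y} (≈-trans (V-⊗ (X ⊗ Y) X) (⊛-congʳ {V X} (V-⊗ X Y))))))))

-- m + m(3m+1)/2 = 3 · m(m+1)/2. This is what makes the terms k = 3m+1 of `theta` a theta series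
-- again, in q⁹.
Xpow-rootTriangular : ∀ m → pow X m ⊗ rootTriangular m ≈ V (triangular m)
Xpow-rootTriangular zero    = ≈-trans (⊛-identityˡ one) (≈-sym V-one)
Xpow-rootTriangular (suc m) = begin
  X ⊗ Y ⊗ ⊝ (X ⊗ Y ⊗ X ⊗ Y ⊗ Y ⊗ r)       ≈⟨ solve 3 (λ x y r → x :* y :* :- (x :* y :* x :* y :* y :* r) := :- (((x :* y) :^ 3) :* (y :* r))) ≈-refl X Y r ⟩
  ⊝ (pow (X ⊗ Y) 3 ⊗ (Y ⊗ r))             ≈⟨ ⊝-cong (⊛-cong cube (Xpow-rootTriangular m)) ⟩
  ⊝ (V (X ⊗ Y) ⊗ V (triangular m))        ≈⟨ ⊝-cong (V-⊗ (X ⊗ Y) (triangular m)) ⟨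
  ⊝ V (X ⊗ Y ⊗ triangular m)              ≈⟨ V-⊝ (X ⊗ Y ⊗ triangular m) ⟨
  V (triangular (suc m))                  ∎
  where
  open ≈-Reasoning
  Y = pow X m
  r = rootTriangular m
  cube : pow (X ⊗ Y) 3 ≈ V (X ⊗ Y)
  cube = ≈-trans (≈-sym (pow-* X 3 (suc m))) (≈-sym (V-Xpow (suc m)))

-- The triangular numbers of 3m, 3m+1, 3m+2 are 0, 1, 0 modulo 3, so the last section is empty. For
-- k = 3m+1 the weight is 3(2m+1), the sign -(-1)^m and the exponent 1 + 9 · m(m+1)/2; these terms
-- reproduce `theta` itself.
theta-*3 : ∀ M → theta (M ℕ.* 3) ≈ assemble
  (sumTo M (λ m → odd (m ℕ.* 3) ⊗ rootTriangular m ⊕ odd (2 ℕ.+ m ℕ.* 3) ⊗ (X ⊗ pow X m ⊗ pow X m ⊗ rootTriangular m)))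
  (⊝ (const (+ 3) ⊗ V (theta M)))
  (const 0ℤ)
theta-*3 M = ≈-trans (go M) (≈-sym (⊕-cong (⊕-congˡ {V (sumTo M F)} (⊛-congˡ {X} (≈-trans (V-⊝ _) (⊝-cong (≈-trans (V-⊗ (const (+ 3)) (V (theta M))) (⊛-congʳ {V (V (theta M))} (V-const (+ 3))))))))
    (⊛-congˡ {X} (⊛-congˡ {X} (V-const 0ℤ)))))
  where
  F : ℕ → Series
  F m = odd (m ℕ.* 3) ⊗ rootTriangular m ⊕ odd (2 ℕ.+ m ℕ.* 3) ⊗ (X ⊗ pow X m ⊗ pow X m ⊗ rootTriangular m)
  open ≈-Reasoning
  go : ∀ M → theta (M ℕ.* 3) ≈ V (sumTo M F) ⊕ X ⊗ ⊝ (const (+ 3) ⊗ V (V (theta M))) ⊕ X ⊗ (X ⊗ const 0ℤ)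
  go zero = ≈-sym (≈-trans (⊕-congʳ (⊕-cong (V-const 0ℤ) (⊛-congˡ {X} (⊝-cong (⊛-congˡ {const (+ 3)} (≈-trans (V-cong (V-const 0ℤ)) (V-const 0ℤ)))))))
    (solve 1 (λ x → con 0ℤ :+ x :* :- (con (+ 3) :* con 0ℤ) :+ x :* (x :* con 0ℤ) := con 0ℤ) ≈-refl X))
  go (suc M) = begin
    theta (M ℕ.* 3) ⊕ odd n ⊗ triangular n ⊕ odd (1 ℕ.+ n) ⊗ ⊝ (X ⊗ Z ⊗ triangular n) ⊕ odd (2 ℕ.+ n) ⊗ ⊝ (X ⊗ (X ⊗ Z) ⊗ ⊝ (X ⊗ Z ⊗ triangular n))
      -- `nat-*3` turns the weight of the middle term into `3 · odd M`; the third relation is the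
      -- trivial 0 = 0.
      ≈⟨ lincomb₃ (const 1ℤ) (⊝ (const (+ 2) ⊗ X ⊗ Z ⊗ triangular n)) (const 1ℤ) (go M) (nat-*3 M) (≈-refl {const 0ℤ})
           (solve 7 (λ S R ν₃ ν x Z t → let odd = λ a → con (+ 2) :* a :+ con 1ℤ in
             S :+ odd ν₃ :* t :+ odd (ν₃ :+ con 1ℤ) :* :- (x :* Z :* t) :+ odd (ν₃ :+ con 1ℤ :+ con 1ℤ) :* :- (x :* (x :* Z) :* :- (x :* Z :* t))
              :- (R :+ odd ν₃ :* t :+ con (+ 3) :* odd ν :* :- (x :* Z :* t) :+ odd (ν₃ :+ con 1ℤ :+ con 1ℤ) :* (x :* (x :* Z) :* (x :* Z :* t)))
             := con 1ℤ :* (S :- R) :+ :- (con (+ 2) :* x :* Z :* t) :* (ν₃ :- con (+ 3) :* ν) :+ con 1ℤ :* (con 0ℤ :- con 0ℤ))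
           ≈-refl (theta n) (V (sumTo M F) ⊕ X ⊗ ⊝ (const (+ 3) ⊗ V (V (theta M))) ⊕ X ⊗ (X ⊗ const 0ℤ)) (nat n) (nat M) X Z (triangular n)) ⟩
    R ⊕ odd n ⊗ t ⊕ const (+ 3) ⊗ odd M ⊗ ⊝ (X ⊗ Z ⊗ t) ⊕ odd (2 ℕ.+ n) ⊗ (X ⊗ (X ⊗ Z) ⊗ (X ⊗ Z ⊗ t))
      ≈⟨ solve 8 (λ S θ w₀ w₂ w x Z t →
           S :+ x :* :- (con (+ 3) :* θ) :+ x :* (x :* con 0ℤ) :+ w₀ :* t :+ con (+ 3) :* w :* :- (x :* Z :* t) :+ w₂ :* (x :* (x :* Z) :* (x :* Z :* t))
           := S :+ (w₀ :* t :+ w₂ :* (x :* (x :* Z) :* (x :* Z :* t))) :+ x :* :- (con (+ 3) :* (θ :+ w :* (Z :* t))) :+ x :* (x :* con 0ℤ))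
         ≈-refl (V (sumTo M F)) (V (V (theta M))) (odd n) (odd (2 ℕ.+ n)) (odd M) X Z t ⟩
    V (sumTo M F) ⊕ (odd n ⊗ t ⊕ odd (2 ℕ.+ n) ⊗ (X ⊗ (X ⊗ Z) ⊗ (X ⊗ Z ⊗ t)))
      ⊕ X ⊗ ⊝ (const (+ 3) ⊗ (V (V (theta M)) ⊕ odd M ⊗ (Z ⊗ t))) ⊕ X ⊗ (X ⊗ const 0ℤ)
      ≈⟨ ⊕-congʳ (⊕-cong (≈-trans (V-⊕ (sumTo M F) (F M)) (⊕-congˡ {V (sumTo M F)} V-F))
           (⊛-congˡ {X} (⊝-cong (⊛-congˡ {const (+ 3)} (≈-trans (V-cong (V-⊕ (theta M) _)) (≈-trans (V-⊕ (V (theta M)) _) (⊕-congˡ {V (V (theta M))} VV-term))))))) ⟨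
    V (sumTo (suc M) F) ⊕ X ⊗ ⊝ (const (+ 3) ⊗ V (V (theta (suc M)))) ⊕ X ⊗ (X ⊗ const 0ℤ) ∎
    where
    n = M ℕ.* 3
    Z = pow X (M ℕ.* 3)
    Y = pow X M
    t = triangular n
    r = rootTriangular M
    R = V (sumTo M F) ⊕ X ⊗ ⊝ (const (+ 3) ⊗ V (V (theta M))) ⊕ X ⊗ (X ⊗ const 0ℤ)
    V-F : V (F M) ≈ odd n ⊗ t ⊕ odd (2 ℕ.+ n) ⊗ (X ⊗ (X ⊗ Z) ⊗ (X ⊗ Z ⊗ t))
    V-F = ≈-trans (V-⊕ (odd n ⊗ r) _) (⊕-cong
      (≈-trans (V-⊗ (odd n) r) (⊛-cong (V-odd n) (≈-sym (triangular-*3 M))))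
      (≈-trans (V-⊗ (odd (2 ℕ.+ n)) (X ⊗ Y ⊗ Y ⊗ r)) (⊛-cong (V-odd (2 ℕ.+ n)) (begin
        V (X ⊗ Y ⊗ Y ⊗ r)               ≈⟨ ≈-trans (V-⊗ (X ⊗ Y ⊗ Y) r) (⊛-congʳ {V r} (≈-trans (V-⊗ (X ⊗ Y) Y) (⊛-congʳ {V Y} (V-⊗ X Y)))) ⟩
        V X ⊗ V Y ⊗ V Y ⊗ V r           ≈⟨ ⊛-cong (⊛-cong (⊛-cong V-X (≈-sym (Xpow-*3 M))) (≈-sym (Xpow-*3 M))) (≈-sym (triangular-*3 M)) ⟩
        pow X 3 ⊗ Z ⊗ Z ⊗ t             ≈⟨ solve 3 (λ x Z t → x :^ 3 :* Z :* Z :* t := x :* (x :* Z) :* (x :* Z :* t)) ≈-refl X Z t ⟩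
        X ⊗ (X ⊗ Z) ⊗ (X ⊗ Z ⊗ t)       ∎))))
    VV-term : V (V (odd M ⊗ triangular M)) ≈ odd M ⊗ (Z ⊗ t)
    VV-term = begin
      V (V (odd M ⊗ triangular M))       ≈⟨ V-cong (≈-trans (V-⊗ (odd M) (triangular M)) (⊛-cong (V-odd M) (≈-sym (Xpow-rootTriangular M)))) ⟩
      V (odd M ⊗ (Y ⊗ r))                ≈⟨ ≈-trans (V-⊗ (odd M) (Y ⊗ r)) (⊛-cong (V-odd M) (V-⊗ Y r)) ⟩
      odd M ⊗ (V Y ⊗ V r)                ≈⟨ ⊛-congˡ {odd M} (⊛-cong (Xpow-*3 M) (triangular-*3 M)) ⟨
      odd M ⊗ (Z ⊗ t)                    ∎

E1³ : Series
E1³ = pow (E 1) 3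

-- M is large enough for two uses: `theta (M * 3)` stands for E₁³ here, and in `U1-E1³` so does the
-- `theta M` inside the middle section.
E1³-assembled : ∀ L → let M = 2 ℕ.+ L ℕ.* 3 in E1³ ≈[ L ℕ.* 3 ] assemble
  (sumTo M (λ m → odd (m ℕ.* 3) ⊗ rootTriangular m ⊕ odd (2 ℕ.+ m ℕ.* 3) ⊗ (X ⊗ pow X m ⊗ pow X m ⊗ rootTriangular m)))
  (⊝ (const (+ 3) ⊗ V (theta M)))
  (const 0ℤ)
E1³-assembled L = ≈[]-trans (weaken (ℕ.n≤1+n _) (jacobi (L ℕ.* 3) (M ℕ.* 3) (ℕ.m≤m*n M 3))) (truncate (theta-*3 M))
  where M = 2 ℕ.+ L ℕ.* 3

U1-E1³ : U 1 E1³ ≈ ⊝ (const (+ 3) ⊗ V E1³)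
U1-E1³ = ≈[]-all λ L → let M = 2 ℕ.+ L ℕ.* 3 in ≈[]-trans (U-cong[] {L} 1 (s≤s (s≤s z≤n)) (E1³-assembled L))
  (≈[]-trans (truncate (U1-assemble _ (⊝ (const (+ 3) ⊗ V (theta M))) (const 0ℤ)))
    (⊝-cong[] (⊗-cong[] {f = const (+ 3)} ≈[]-refl (weaken (ℕ.m≤m*n L 3) (V-cong[] {L} (≈[]-sym
      (weaken (ℕ.≤-trans (ℕ.m≤m*n L 3) (ℕ.n≤1+n _)) (jacobi (L ℕ.* 3) M ℕ.≤-refl))))))))

U2-E1³ : U 2 E1³ ≈ const 0ℤ
U2-E1³ = ≈[]-all λ L → let M = 2 ℕ.+ L ℕ.* 3 in ≈[]-trans (U-cong[] {L} 2 (s≤s (s≤s (s≤s z≤n))) (E1³-assembled L))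
  (truncate (U2-assemble _ (⊝ (const (+ 3) ⊗ V (theta M))) (const 0ℤ)))

-- The cubic norm

assemble-⊗ : ∀ a b c g → assemble a b c ⊗ g ≈ V a ⊗ g ⊕ X ⊗ (V b ⊗ g) ⊕ X ⊗ (X ⊗ (V c ⊗ g))
assemble-⊗ a b c g = solve 5 (λ x a b c g → (a :+ x :* b :+ x :* (x :* c)) :* g := a :* g :+ x :* (b :* g) :+ x :* (x :* (c :* g)))
  ≈-refl X (V a) (V b) (V c) g

U0-⊗ : ∀ f g → U 0 (f ⊗ g) ≈ U 0 f ⊗ U 0 g ⊕ X ⊗ (U 1 f ⊗ U 2 g ⊕ U 2 f ⊗ U 1 g)
U0-⊗ f g = begin
  U 0 (f ⊗ g)                                              ≈⟨ U-cong 0 (≈-trans (⊛-congʳ {g} (assemble-U f)) (assemble-⊗ a b c g)) ⟩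
  U 0 (V a ⊗ g) ⊕ U 0 (X ⊗ (V b ⊗ g)) ⊕ U 0 (X ⊗ (X ⊗ (V c ⊗ g)))
    ≈⟨ ⊕-cong (⊕-cong (U0-V⊗ a g) (≈-trans (U0-X⊗ (V b ⊗ g)) (⊛-congˡ {X} (U2-V⊗ b g))))
              (≈-trans (U0-X⊗ (X ⊗ (V c ⊗ g))) (⊛-congˡ {X} (≈-trans (U2-X⊗ (V c ⊗ g)) (U1-V⊗ c g)))) ⟩
  a ⊗ U 0 g ⊕ X ⊗ (b ⊗ U 2 g) ⊕ X ⊗ (c ⊗ U 1 g)            ≈⟨ solve 4 (λ x p q r → p :+ x :* q :+ x :* r := p :+ x :* (q :+ r)) ≈-refl X (a ⊗ U 0 g) (b ⊗ U 2 g) (c ⊗ U 1 g) ⟩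
  a ⊗ U 0 g ⊕ X ⊗ (b ⊗ U 2 g ⊕ c ⊗ U 1 g)                  ∎
  where
  open ≈-Reasoning
  a = U 0 f
  b = U 1 f
  c = U 2 f

U1-⊗ : ∀ f g → U 1 (f ⊗ g) ≈ U 0 f ⊗ U 1 g ⊕ U 1 f ⊗ U 0 g ⊕ X ⊗ (U 2 f ⊗ U 2 g)
U1-⊗ f g = begin
  U 1 (f ⊗ g)                                              ≈⟨ U-cong 1 (≈-trans (⊛-congʳ {g} (assemble-U f)) (assemble-⊗ a b c g)) ⟩
  U 1 (V a ⊗ g) ⊕ U 1 (X ⊗ (V b ⊗ g)) ⊕ U 1 (X ⊗ (X ⊗ (V c ⊗ g)))
    ≈⟨ ⊕-cong (⊕-cong (U1-V⊗ a g) (≈-trans (U1-X⊗ (V b ⊗ g)) (U0-V⊗ b g)))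
              (≈-trans (U1-X⊗ (X ⊗ (V c ⊗ g))) (≈-trans (U0-X⊗ (V c ⊗ g)) (⊛-congˡ {X} (U2-V⊗ c g)))) ⟩
  a ⊗ U 1 g ⊕ b ⊗ U 0 g ⊕ X ⊗ (c ⊗ U 2 g)                  ∎
  where
  open ≈-Reasoning
  a = U 0 f
  b = U 1 f
  c = U 2 f

U2-⊗ : ∀ f g → U 2 (f ⊗ g) ≈ U 0 f ⊗ U 2 g ⊕ U 1 f ⊗ U 1 g ⊕ U 2 f ⊗ U 0 g
U2-⊗ f g = begin
  U 2 (f ⊗ g)                                              ≈⟨ U-cong 2 (≈-trans (⊛-congʳ {g} (assemble-U f)) (assemble-⊗ a b c g)) ⟩
  U 2 (V a ⊗ g) ⊕ U 2 (X ⊗ (V b ⊗ g)) ⊕ U 2 (X ⊗ (X ⊗ (V c ⊗ g)))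
    ≈⟨ ⊕-cong (⊕-cong (U2-V⊗ a g) (≈-trans (U2-X⊗ (V b ⊗ g)) (U1-V⊗ b g)))
              (≈-trans (U2-X⊗ (X ⊗ (V c ⊗ g))) (≈-trans (U1-X⊗ (V c ⊗ g)) (U0-V⊗ c g))) ⟩
  a ⊗ U 2 g ⊕ b ⊗ U 1 g ⊕ c ⊗ U 0 g                        ∎
  where
  open ≈-Reasoning
  a = U 0 f
  b = U 1 f
  c = U 2 f

-- Norm of a + bθ + cθ² for θ³ = q; with a, b, c = U 0 f, U 1 f, U 2 f it is
-- the product of f over the substitutions q ↦ ωq (ω³ = 1), read in q³.
norm₃ : Series → Series → Series → Series
norm₃ a b c = pow a 3 ⊕ X ⊗ pow b 3 ⊕ pow X 2 ⊗ pow c 3 ⊕ ⊝ (const (+ 3) ⊗ X ⊗ a ⊗ b ⊗ c)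

norm : Series → Series
norm f = norm₃ (U 0 f) (U 1 f) (U 2 f)

norm₃-cong[] : ∀ {N a a′ b b′ c c′} → a ≈[ N ] a′ → b ≈[ N ] b′ → c ≈[ N ] c′ → norm₃ a b c ≈[ N ] norm₃ a′ b′ c′
norm₃-cong[] p q r = ⊕-cong[] (⊕-cong[] (⊕-cong[] (pow-cong[] 3 p) (⊗-cong[] {f = X} ≈[]-refl (pow-cong[] 3 q))) (⊗-cong[] {f = pow X 2} ≈[]-refl (pow-cong[] 3 r)))
  (⊝-cong[] (⊗-cong[] (⊗-cong[] (⊗-cong[] {f = const (+ 3) ⊗ X} ≈[]-refl p) q) r))

norm₃-cong : ∀ {a a′ b b′ c c′} → a ≈ a′ → b ≈ b′ → c ≈ c′ → norm₃ a b c ≈ norm₃ a′ b′ c′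
norm₃-cong p q r = ≈[]-all λ N → norm₃-cong[] (truncate p) (truncate q) (truncate r)

norm-cong[] : ∀ {N f g} → f ≈[ N ℕ.* 3 ] g → norm f ≈[ N ] norm g
norm-cong[] {N} h = norm₃-cong[] (U-cong[] {N} 0 (s≤s z≤n) h) (U-cong[] {N} 1 (s≤s (s≤s z≤n)) h) (U-cong[] {N} 2 (s≤s (s≤s (s≤s z≤n))) h)

norm-cong : ∀ {f g} → f ≈ g → norm f ≈ norm g
norm-cong h = ≈[]-all λ N → norm-cong[] (truncate h)

norm-assemble : ∀ a b c → norm (assemble a b c) ≈ norm₃ a b c
norm-assemble a b c = norm₃-cong (U0-assemble a b c) (U1-assemble a b c) (U2-assemble a b c)

norm-V : ∀ f → norm (V f) ≈ pow f 3
norm-V f = ≈-trans (norm₃-cong (U0-V f) (U1-V f) (U2-V f))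
  (solve 2 (λ x f → f :^ 3 :+ x :* con 0ℤ :^ 3 :+ x :^ 2 :* con 0ℤ :^ 3 :- con (+ 3) :* x :* f :* con 0ℤ :* con 0ℤ := f :^ 3) ≈-refl X f)

-- The formulas for the sections of a product are the multiplication table of 1, θ, θ² with θ³ = q,
-- which leaves a polynomial identity.
norm-⊗ : ∀ f g → norm (f ⊗ g) ≈ norm f ⊗ norm g
norm-⊗ f g = ≈-trans (norm₃-cong (U0-⊗ f g) (U1-⊗ f g) (U2-⊗ f g))
  (solve 7 (λ q a b c x y z → let nm = λ a b c → a :^ 3 :+ q :* b :^ 3 :+ q :^ 2 :* c :^ 3 :- con (+ 3) :* q :* a :* b :* c in
     nm (a :* x :+ q :* (b :* z :+ c :* y)) (a :* y :+ b :* x :+ q :* (c :* z)) (a :* z :+ b :* y :+ c :* x) := nm a b c :* nm x y z)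
   ≈-refl X (U 0 f) (U 1 f) (U 2 f) (U 0 g) (U 1 g) (U 2 g))

norm-one : norm one ≈ one
norm-one = ≈-trans (norm-cong (≈-sym V-one)) (≈-trans (norm-V one) (pow-one 3))

norm-pow : ∀ f k → norm (pow f k) ≈ pow (norm f) k
norm-pow f zero    = norm-one
norm-pow f (suc k) = ≈-trans (norm-⊗ f (pow f k)) (⊛-congˡ {norm f} (norm-pow f k))

Xpow-cube : ∀ m → pow (pow X m) 3 ≈ pow X (m ℕ.* 3)
Xpow-cube m = ≈-trans (≈-sym (pow-* X 3 m)) (reflexive (cong (pow X) (ℕ.*-comm 3 m)))

V-1-X^′ : ∀ m → V (1-X^ m) ≈ 1-X^ (m ℕ.* 3)
V-1-X^′ m = ≈-trans (V-1-X^ m) (reflexive (cong 1-X^ (ℕ.*-comm 3 m)))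

-- Over the three substitutions q ↦ ωq, the product of 1 - qⁿ is (1 - qⁿ)³ if 3 divides n and 1 -
-- q³ⁿ otherwise. Read in q³, the first is a cube of a factor with index n/3 and the second is 1 -
-- qⁿ again; the next two lemmas treat the latter.
norm-1-X^0 : ∀ m → norm (1-X^ (m ℕ.* 3)) ≈ pow (1-X^ m) 3
norm-1-X^0 m = ≈-trans (norm-cong (≈-sym (V-1-X^′ m))) (norm-V (1-X^ m))

norm-1-X^1 : ∀ m → norm (1-X^ (1 ℕ.+ m ℕ.* 3)) ≈ 1-X^ (1 ℕ.+ m ℕ.* 3)
norm-1-X^1 m = begin
  norm (1-X^ (1 ℕ.+ m ℕ.* 3))                 ≈⟨ norm-cong split ⟩
  norm (assemble one (⊝ pow X m) (const 0ℤ))  ≈⟨ norm-assemble one (⊝ pow X m) (const 0ℤ) ⟩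
  norm₃ one (⊝ pow X m) (const 0ℤ)            ≈⟨ solve 2 (λ x y → let o = x :^ 0 in o :^ 3 :+ x :* (:- y) :^ 3 :+ x :^ 2 :* con 0ℤ :^ 3 :- con (+ 3) :* x :* o :* :- y :* con 0ℤ := o :- x :* y :^ 3) ≈-refl X (pow X m) ⟩
  one ⊕ ⊝ (X ⊗ pow (pow X m) 3)               ≈⟨ ⊕-congˡ {one} (⊝-cong (⊛-congˡ {X} (Xpow-cube m))) ⟩
  1-X^ (1 ℕ.+ m ℕ.* 3)                        ∎
  where
  open ≈-Reasoning
  split : 1-X^ (1 ℕ.+ m ℕ.* 3) ≈ assemble one (⊝ pow X m) (const 0ℤ)
  split = ≈-trans (solve 3 (λ o x y → o :- x :* y := o :+ x :* (:- y) :+ x :* (x :* con 0ℤ)) ≈-refl one X (pow X (m ℕ.* 3)))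
    (≈-sym (⊕-cong (⊕-cong V-one (⊛-congˡ {X} (≈-trans (V-⊝ (pow X m)) (⊝-cong (≈-sym (Xpow-*3 m)))))) (⊛-congˡ {X} (⊛-congˡ {X} (V-const 0ℤ)))))

norm-1-X^2 : ∀ m → norm (1-X^ (2 ℕ.+ m ℕ.* 3)) ≈ 1-X^ (2 ℕ.+ m ℕ.* 3)
norm-1-X^2 m = begin
  norm (1-X^ (2 ℕ.+ m ℕ.* 3))                 ≈⟨ norm-cong split ⟩
  norm (assemble one (const 0ℤ) (⊝ pow X m))  ≈⟨ norm-assemble one (const 0ℤ) (⊝ pow X m) ⟩
  norm₃ one (const 0ℤ) (⊝ pow X m)            ≈⟨ solve 2 (λ x y → let o = x :^ 0 in o :^ 3 :+ x :* con 0ℤ :^ 3 :+ x :^ 2 :* (:- y) :^ 3 :- con (+ 3) :* x :* o :* con 0ℤ :* :- y := o :- x :* (x :* y :^ 3)) ≈-refl X (pow X m) ⟩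
  one ⊕ ⊝ (X ⊗ (X ⊗ pow (pow X m) 3))         ≈⟨ ⊕-congˡ {one} (⊝-cong (⊛-congˡ {X} (⊛-congˡ {X} (Xpow-cube m)))) ⟩
  1-X^ (2 ℕ.+ m ℕ.* 3)                        ∎
  where
  open ≈-Reasoning
  split : 1-X^ (2 ℕ.+ m ℕ.* 3) ≈ assemble one (const 0ℤ) (⊝ pow X m)
  split = ≈-trans (solve 3 (λ o x y → o :- x :* (x :* y) := o :+ x :* con 0ℤ :+ x :* (x :* :- y)) ≈-refl one X (pow X (m ℕ.* 3)))
    (≈-sym (⊕-cong (⊕-cong V-one (⊛-congˡ {X} (V-const 0ℤ))) (⊛-congˡ {X} (⊛-congˡ {X} (≈-trans (V-⊝ (pow X m)) (⊝-cong (≈-sym (Xpow-*3 m))))))))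

-- A block f₁f₂f₃ of three factors has norm f₁f₂g³, and the missing f₃ is `V g`. In the limit the
-- norm of E₁ is E₁⁴/E₃.
norm-D : ∀ N → norm (D (N ℕ.* 3)) ⊗ V (D N) ≈ D (N ℕ.* 3) ⊗ pow (D N) 3
norm-D zero    = ≈-trans (⊛-cong norm-one V-one) (solve 1 (λ x → x :^ 0 :* x :^ 0 := x :^ 0 :* (x :^ 0) :^ 3) ≈-refl X)
norm-D (suc N) = begin
  norm (D n ⊗ f₁ ⊗ f₂ ⊗ f₃) ⊗ V (D N ⊗ g)
    ≈⟨ ⊛-cong (≈-trans (norm-⊗ (D n ⊗ f₁ ⊗ f₂) f₃) (⊛-cong (≈-trans (norm-⊗ (D n ⊗ f₁) f₂) (⊛-cong (≈-trans (norm-⊗ (D n) f₁)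
         (⊛-congˡ {norm (D n)} (norm-1-X^1 N))) (norm-1-X^2 N))) (norm-1-X^0 (suc N))))
         (≈-trans (V-⊗ (D N) g) (⊛-congˡ {V (D N)} (V-1-X^′ (suc N)))) ⟩
  norm (D n) ⊗ f₁ ⊗ f₂ ⊗ pow g 3 ⊗ (V (D N) ⊗ f₃)
    ≈⟨ solve 6 (λ a f₁ f₂ f₃ g d → a :* f₁ :* f₂ :* g :* (d :* f₃) := (a :* d) :* (f₁ :* f₂ :* f₃ :* g)) ≈-refl (norm (D n)) f₁ f₂ f₃ (pow g 3) (V (D N)) ⟩
  norm (D n) ⊗ V (D N) ⊗ (f₁ ⊗ f₂ ⊗ f₃ ⊗ pow g 3)
    ≈⟨ ⊛-congʳ {f₁ ⊗ f₂ ⊗ f₃ ⊗ pow g 3} (norm-D N) ⟩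
  D n ⊗ pow (D N) 3 ⊗ (f₁ ⊗ f₂ ⊗ f₃ ⊗ pow g 3)
    ≈⟨ solve 6 (λ a f₁ f₂ f₃ g d → a :* d :* (f₁ :* f₂ :* f₃ :* g) := a :* f₁ :* f₂ :* f₃ :* (d :* g)) ≈-refl (D n) f₁ f₂ f₃ (pow g 3) (pow (D N) 3) ⟩
  D n ⊗ f₁ ⊗ f₂ ⊗ f₃ ⊗ (pow (D N) 3 ⊗ pow g 3)
    ≈⟨ ⊛-congˡ {D n ⊗ f₁ ⊗ f₂ ⊗ f₃} (pow-⊗ (D N) g 3) ⟨
  D (suc N ℕ.* 3) ⊗ pow (D (suc N)) 3 ∎
  where
  open ≈-Reasoning
  n = N ℕ.* 3
  f₁ = 1-X^ (1 ℕ.+ n)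
  f₂ = 1-X^ (2 ℕ.+ n)
  f₃ = 1-X^ (3 ℕ.+ n)
  g = 1-X^ (suc N)

norm-E1 : norm (E 1) ⊗ V (E 1) ≈ pow (E 1) 4
norm-E1 = ≈[]-all λ N → let D3≈ = E1-limit (N ℕ.* 3) ; D≈ = weaken (ℕ.n≤1+n N) (E1-limit N) in
  ≈[]-trans (⊗-cong[] (norm-cong[] {N} (weaken (ℕ.n≤1+n _) D3≈)) (weaken (ℕ.m≤m*n N 3) (V-cong[] {N} D≈)))
  (≈[]-trans (truncate (norm-D N)) (≈[]-sym (⊗-cong[] (weaken (ℕ.≤-trans (ℕ.m≤m*n N 3) (ℕ.n≤1+n _)) D3≈) (pow-cong[] 3 D≈))))

E3³ P : Series
E3³ = V E1³
P   = U 0 E1³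

E1³-dissection : E1³ ≈ V P ⊕ ⊝ (const (+ 3) ⊗ X ⊗ V E3³)
E1³-dissection = begin
  E1³                                                                       ≈⟨ assemble-U E1³ ⟩
  assemble P (U 1 E1³) (U 2 E1³)                                            ≈⟨ assemble-cong ≈-refl U1-E1³ U2-E1³ ⟩
  V P ⊕ X ⊗ V (⊝ (const (+ 3) ⊗ E3³)) ⊕ X ⊗ (X ⊗ V (const 0ℤ))              ≈⟨ ⊕-cong (⊕-congˡ {V P} (⊛-congˡ {X} (≈-trans (V-⊝ _) (⊝-cong (≈-trans (V-⊗ (const (+ 3)) E3³) (⊛-congʳ {V E3³} (V-const (+ 3)))))))) (⊛-congˡ {X} (⊛-congˡ {X} (V-const 0ℤ))) ⟩
  V P ⊕ X ⊗ ⊝ (const (+ 3) ⊗ V E3³) ⊕ X ⊗ (X ⊗ const 0ℤ)                    ≈⟨ solve 3 (λ p x v → p :+ x :* :- (con (+ 3) :* v) :+ x :* (x :* con 0ℤ) := p :- con (+ 3) :* x :* v) ≈-refl (V P) X (V E3³) ⟩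
  V P ⊕ ⊝ (const (+ 3) ⊗ X ⊗ V E3³)                                         ∎
  where open ≈-Reasoning

P-cubed : (pow P 3 ⊕ ⊝ (const (+ 27) ⊗ X ⊗ pow E3³ 3)) ⊗ E3³ ≈ pow E1³ 4
P-cubed = begin
  (pow P 3 ⊕ ⊝ (const (+ 27) ⊗ X ⊗ pow E3³ 3)) ⊗ E3³  ≈⟨ ⊛-congʳ {E3³} (solve 3 (λ x p w → p :^ 3 :- con (+ 27) :* x :* w :^ 3
                                                           := p :^ 3 :+ x :* (:- (con (+ 3) :* w)) :^ 3 :+ x :^ 2 :* con 0ℤ :^ 3 :- con (+ 3) :* x :* p :* :- (con (+ 3) :* w) :* con 0ℤ) ≈-refl X P E3³) ⟩
  norm₃ P (⊝ (const (+ 3) ⊗ E3³)) (const 0ℤ) ⊗ E3³    ≈⟨ ⊛-congʳ {E3³} (norm₃-cong (≈-refl {P}) U1-E1³ U2-E1³) ⟨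
  norm E1³ ⊗ E3³                                      ≈⟨ ⊛-cong (norm-pow (E 1) 3) (V-pow (E 1) 3) ⟩
  pow (norm (E 1)) 3 ⊗ pow (V (E 1)) 3                ≈⟨ pow-⊗ (norm (E 1)) (V (E 1)) 3 ⟨
  pow (norm (E 1) ⊗ V (E 1)) 3                        ≈⟨ pow-cong 3 norm-E1 ⟩
  pow (pow (E 1) 4) 3                                 ≈⟨ pow-* (E 1) 3 4 ⟨
  pow (E 1) 12                                        ≈⟨ pow-* (E 1) 4 3 ⟩
  pow E1³ 4                                           ∎
  where open ≈-Reasoning

-- The series ζ and the matrix m

-- κ = E₁¹²/E₃³ is the value of P³ - 27q E₃⁹. It is a unit and serves as common denominator for the
-- sections of 1/E₁³.
E1⁻³ E3⁻³ κ τ ζ : Series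
E1⁻³ = pow (Einv 1) 3
E3⁻³ = V E1⁻³
κ    = E3⁻³ ⊗ pow E1³ 4
τ    = X ⊗ pow E3³ 4 ⊗ pow E1⁻³ 4
ζ    = X ⊗ V E3³ ⊗ E1⁻³

E1³-inverse : E1³ ⊗ E1⁻³ ≈ one
E1³-inverse = ≈-trans (≈-sym (pow-⊗ (E 1) (Einv 1) 3)) (≈-trans (pow-cong 3 (E⊗Einv 0)) (pow-one 3))

E3³-inverse : E3³ ⊗ E3⁻³ ≈ one
E3³-inverse = ≈-trans (≈-sym (V-⊗ E1³ E1⁻³)) (≈-trans (V-cong E1³-inverse) V-one)

E1³⁴-inverse : pow E1³ 4 ⊗ pow E1⁻³ 4 ≈ one
E1³⁴-inverse = ≈-trans (≈-sym (pow-⊗ E1³ E1⁻³ 4)) (≈-trans (pow-cong 4 E1³-inverse) (pow-one 4))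

κ-inverse : E3³ ⊗ pow E1⁻³ 4 ⊗ κ ≈ one
κ-inverse = begin
  E3³ ⊗ pow E1⁻³ 4 ⊗ (E3⁻³ ⊗ pow E1³ 4)    ≈⟨ solve 4 (λ w i w′ t → w :* i :* (w′ :* t) := w :* w′ :* (t :* i)) ≈-refl E3³ (pow E1⁻³ 4) E3⁻³ (pow E1³ 4) ⟩
  E3³ ⊗ E3⁻³ ⊗ (pow E1³ 4 ⊗ pow E1⁻³ 4)    ≈⟨ ⊛-cong E3³-inverse E1³⁴-inverse ⟩
  one ⊗ one                                ≈⟨ ⊛-identityˡ one ⟩
  one                                      ∎
  where open ≈-Reasoning

κ-expand : κ ≈ pow P 3 ⊕ ⊝ (const (+ 27) ⊗ X ⊗ pow E3³ 3)
κ-expand = begin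
  E3⁻³ ⊗ pow E1³ 4        ≈⟨ ⊛-congˡ {E3⁻³} P-cubed ⟨
  E3⁻³ ⊗ (R ⊗ E3³)        ≈⟨ solve 3 (λ i r w → i :* (r :* w) := w :* i :* r) ≈-refl E3⁻³ R E3³ ⟩
  E3³ ⊗ E3⁻³ ⊗ R          ≈⟨ ⊛-congʳ {R} E3³-inverse ⟩
  one ⊗ R                 ≈⟨ ⊛-identityˡ R ⟩
  R                       ∎
  where
  open ≈-Reasoning
  R = pow P 3 ⊕ ⊝ (const (+ 27) ⊗ X ⊗ pow E3³ 3)

κ⊗τ : κ ⊗ τ ≈ X ⊗ pow E3³ 3
κ⊗τ = begin
  E3⁻³ ⊗ pow E1³ 4 ⊗ (X ⊗ pow E3³ 4 ⊗ pow E1⁻³ 4)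
    ≈⟨ solve 5 (λ w w′ t i x → w′ :* t :* (x :* w :^ 4 :* i) := w :* w′ :* (t :* i) :* (x :* w :^ 3)) ≈-refl E3³ E3⁻³ (pow E1³ 4) (pow E1⁻³ 4) X ⟩
  E3³ ⊗ E3⁻³ ⊗ (pow E1³ 4 ⊗ pow E1⁻³ 4) ⊗ (X ⊗ pow E3³ 3)
    ≈⟨ ⊛-congʳ {X ⊗ pow E3³ 3} (≈-trans (⊛-cong E3³-inverse E1³⁴-inverse) (⊛-identityˡ one)) ⟩
  one ⊗ (X ⊗ pow E3³ 3)
    ≈⟨ ⊛-identityˡ (X ⊗ pow E3³ 3) ⟩
  X ⊗ pow E3³ 3 ∎
  where open ≈-Reasoning

P₃ E9³ : Series
P₃ = V P
E9³ = V E3³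

Vκ-expand : V κ ≈ pow P₃ 3 ⊕ ⊝ (const (+ 27) ⊗ pow X 3 ⊗ pow E9³ 3)
Vκ-expand = ≈-trans (V-cong κ-expand) (≈-trans (V-⊕ (pow P 3) _) (⊕-cong (V-pow P 3) (≈-trans (V-⊝ _) (⊝-cong
  (≈-trans (V-⊗ (const (+ 27) ⊗ X) (pow E3³ 3)) (⊛-cong (≈-trans (V-⊗ (const (+ 27)) X) (⊛-cong (V-const (+ 27)) V-X)) (V-pow E3³ 3)))))))

-- `V κ` is the difference of cubes P₃³ - (3q E₉³)³, and E₁³ = P₃ - 3q E₉³ divides it. The cofactor
-- P₃² + 3q P₃E₉³ + 9q² E₉⁶ is already split by exponents modulo 3.
Vκ⊗E1⁻³ : V κ ⊗ E1⁻³ ≈ assemble (pow P 2) (const (+ 3) ⊗ P ⊗ E3³) (const (+ 9) ⊗ pow E3³ 2)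
Vκ⊗E1⁻³ = begin
  V κ ⊗ E1⁻³                                                    ≈⟨ ⊛-congʳ {E1⁻³} Vκ-expand ⟩
  (pow P₃ 3 ⊕ ⊝ (const (+ 27) ⊗ pow X 3 ⊗ pow E9³ 3)) ⊗ E1⁻³       ≈⟨ lincomb₂ (⊝ (E1⁻³ ⊗ K)) K E1³-dissection E1³-inverse
     (solve 5 (λ t p x v i → let K = p :^ 2 :+ con (+ 3) :* x :* p :* v :+ con (+ 9) :* x :^ 2 :* v :^ 2 in
       (p :^ 3 :- con (+ 27) :* x :^ 3 :* v :^ 3) :* i :- K
       := :- (i :* K) :* (t :- (p :- con (+ 3) :* x :* v)) :+ K :* (t :* i :- x :^ 0)) ≈-refl E1³ P₃ X E9³ E1⁻³) ⟩
  K                                                             ≈⟨ solve 3 (λ p x v → p :^ 2 :+ con (+ 3) :* x :* p :* v :+ con (+ 9) :* x :^ 2 :* v :^ 2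
                                                                     := p :^ 2 :+ x :* (con (+ 3) :* p :* v) :+ x :* (x :* (con (+ 9) :* v :^ 2))) ≈-refl P₃ X E9³ ⟩
  pow P₃ 2 ⊕ X ⊗ (const (+ 3) ⊗ P₃ ⊗ E9³) ⊕ X ⊗ (X ⊗ (const (+ 9) ⊗ pow E9³ 2))
    ≈⟨ ⊕-cong (⊕-cong (V-pow P 2) (⊛-congˡ {X} (≈-trans (V-⊗ (const (+ 3) ⊗ P) E3³) (⊛-congʳ {E9³} (≈-trans (V-⊗ (const (+ 3)) P) (⊛-congʳ {P₃} (V-const (+ 3))))))))
         (⊛-congˡ {X} (⊛-congˡ {X} (≈-trans (V-⊗ (const (+ 9)) (pow E3³ 2)) (⊛-cong (V-const (+ 9)) (V-pow E3³ 2))))) ⟨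
  assemble (pow P 2) (const (+ 3) ⊗ P ⊗ E3³) (const (+ 9) ⊗ pow E3³ 2) ∎
  where
  open ≈-Reasoning
  K = pow P₃ 2 ⊕ const (+ 3) ⊗ X ⊗ P₃ ⊗ E9³ ⊕ const (+ 9) ⊗ pow X 2 ⊗ pow E9³ 2

H : ℕ → Series
H i = U 0 (pow ζ i)

κ⊗U2-E1⁻³ : κ ⊗ U 2 E1⁻³ ≈ const (+ 9) ⊗ pow E3³ 2
κ⊗U2-E1⁻³ = ≈-trans (≈-sym (U2-V⊗ κ E1⁻³)) (≈-trans (U-cong 2 Vκ⊗E1⁻³)
  (U2-assemble (pow P 2) (const (+ 3) ⊗ P ⊗ E3³) (const (+ 9) ⊗ pow E3³ 2)))

-- ζ is q/E₁³ times a series in q³, so only the section `U 2` of 1/E₁³ matters, which is 9E₃⁶/κ. The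
-- factor q E₃³ and `κ⊗τ` make this 9τ.
H-1 : H 1 ≈ const (+ 9) ⊗ τ
H-1 = ⊗-cancel-unit {κ} {E3³ ⊗ pow E1⁻³ 4} κ-inverse (begin
  κ ⊗ U 0 (ζ ⊗ one)                   ≈⟨ ⊛-congˡ {κ} (U-cong 0 (solve 3 (λ x v i → x :* v :* i :* x :^ 0 := v :* (x :* i)) ≈-refl X E9³ E1⁻³)) ⟩
  κ ⊗ U 0 (E9³ ⊗ (X ⊗ E1⁻³))            ≈⟨ ⊛-congˡ {κ} (≈-trans (U0-V⊗ E3³ (X ⊗ E1⁻³)) (⊛-congˡ {E3³} (U0-X⊗ E1⁻³))) ⟩
  κ ⊗ (E3³ ⊗ (X ⊗ U 2 E1⁻³))          ≈⟨ lincomb₂ (E3³ ⊗ X) (⊝ const (+ 9)) κ⊗U2-E1⁻³ κ⊗τ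
                                          (solve 5 (λ c w x u τ → c :* (w :* (x :* u)) :- c :* (con (+ 9) :* τ)
                                            := w :* x :* (c :* u :- con (+ 9) :* w :^ 2) :+ :- con (+ 9) :* (c :* τ :- x :* w :^ 3)) ≈-refl κ E3³ X (U 2 E1⁻³) τ) ⟩
  κ ⊗ (const (+ 9) ⊗ τ)               ∎)
  where open ≈-Reasoning

-- As for `H-1`, only `U 1` of 1/E₁⁶ matters; it comes from squaring the dissection of 1/E₁³.
-- Replacing P³ by κ + 27q E₃⁹ gives the coefficient 243 = 6 · 27 + 81 of τ².
H-2 : H 2 ≈ const (+ 6) ⊗ τ ⊕ const (+ 243) ⊗ (τ ⊗ τ)
H-2 = ⊗-cancel-unit {κ ⊗ κ} {E3³ ⊗ pow E1⁻³ 4 ⊗ (E3³ ⊗ pow E1⁻³ 4)} κκ-inverse (begin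
  κ ⊗ κ ⊗ U 0 (ζ ⊗ (ζ ⊗ one))
    ≈⟨ ⊛-congˡ {κ ⊗ κ} (U-cong 0 (solve 3 (λ x v i → x :* v :* i :* (x :* v :* i :* x :^ 0) := v :* (v :* (x :* (x :* (i :* i))))) ≈-refl X E9³ E1⁻³)) ⟩
  κ ⊗ κ ⊗ U 0 (E9³ ⊗ (E9³ ⊗ (X ⊗ (X ⊗ (E1⁻³ ⊗ E1⁻³)))))
    ≈⟨ ⊛-congˡ {κ ⊗ κ} (≈-trans (U0-V⊗ E3³ (E9³ ⊗ (X ⊗ (X ⊗ (E1⁻³ ⊗ E1⁻³))))) (⊛-congˡ {E3³} (≈-trans (U0-V⊗ E3³ (X ⊗ (X ⊗ (E1⁻³ ⊗ E1⁻³)))) (⊛-congˡ {E3³} (≈-trans (U0-X⊗ (X ⊗ (E1⁻³ ⊗ E1⁻³))) (⊛-congˡ {X} (U2-X⊗ (E1⁻³ ⊗ E1⁻³)))))))) ⟩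
  κ ⊗ κ ⊗ (E3³ ⊗ (E3³ ⊗ (X ⊗ S)))
    ≈⟨ lincomb₃ (pow E3³ 2 ⊗ X) (⊝ (const (+ 6) ⊗ X ⊗ pow E3³ 3)) (⊝ (const (+ 6) ⊗ κ ⊕ const (+ 243) ⊗ X ⊗ pow E3³ 3 ⊕ const (+ 243) ⊗ κ ⊗ τ))
         κ²S κ-expand κ⊗τ
         (solve 6 (λ c w x S τ P → c :* c :* (w :* (w :* (x :* S))) :- c :* c :* (con (+ 6) :* τ :+ con (+ 243) :* (τ :* τ))
           := w :^ 2 :* x :* (c :* c :* S :- (con (+ 6) :* P :^ 3 :* w :+ con (+ 81) :* x :* w :^ 4))
              :+ :- (con (+ 6) :* x :* w :^ 3) :* (c :- (P :^ 3 :- con (+ 27) :* x :* w :^ 3))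
              :+ :- (con (+ 6) :* c :+ con (+ 243) :* x :* w :^ 3 :+ con (+ 243) :* c :* τ) :* (c :* τ :- x :* w :^ 3))
          ≈-refl κ E3³ X S τ P) ⟩
  κ ⊗ κ ⊗ (const (+ 6) ⊗ τ ⊕ const (+ 243) ⊗ (τ ⊗ τ)) ∎)
  where
  open ≈-Reasoning
  S = U 1 (E1⁻³ ⊗ E1⁻³)
  κ⁻¹ = E3³ ⊗ pow E1⁻³ 4
  κκ-inverse : κ⁻¹ ⊗ κ⁻¹ ⊗ (κ ⊗ κ) ≈ one
  κκ-inverse = ≈-trans (solve 2 (λ a b → a :* a :* (b :* b) := a :* b :* (a :* b)) ≈-refl κ⁻¹ κ) (≈-trans (⊛-cong κ-inverse κ-inverse) (⊛-identityˡ one))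
  a₀ = pow P 2
  a₁ = const (+ 3) ⊗ P ⊗ E3³
  a₂ = const (+ 9) ⊗ pow E3³ 2
  κ²S : κ ⊗ κ ⊗ S ≈ const (+ 6) ⊗ pow P 3 ⊗ E3³ ⊕ const (+ 81) ⊗ X ⊗ pow E3³ 4
  κ²S = begin
    κ ⊗ κ ⊗ S                                        ≈⟨ U1-V⊗ (κ ⊗ κ) (E1⁻³ ⊗ E1⁻³) ⟨
    U 1 (V (κ ⊗ κ) ⊗ (E1⁻³ ⊗ E1⁻³))                  ≈⟨ U-cong 1 (≈-trans (⊛-congʳ {E1⁻³ ⊗ E1⁻³} (V-⊗ κ κ)) (solve 2 (λ a b → a :* a :* (b :* b) := a :* b :* (a :* b)) ≈-refl (V κ) E1⁻³)) ⟩
    U 1 (V κ ⊗ E1⁻³ ⊗ (V κ ⊗ E1⁻³))                  ≈⟨ U-cong 1 (⊛-cong Vκ⊗E1⁻³ Vκ⊗E1⁻³) ⟩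
    U 1 (A ⊗ A)                                      ≈⟨ U1-⊗ A A ⟩
    U 0 A ⊗ U 1 A ⊕ U 1 A ⊗ U 0 A ⊕ X ⊗ (U 2 A ⊗ U 2 A)
      ≈⟨ ⊕-cong (⊕-cong (⊛-cong (U0-assemble a₀ a₁ a₂) (U1-assemble a₀ a₁ a₂)) (⊛-cong (U1-assemble a₀ a₁ a₂) (U0-assemble a₀ a₁ a₂)))
           (⊛-congˡ {X} (⊛-cong (U2-assemble a₀ a₁ a₂) (U2-assemble a₀ a₁ a₂))) ⟩
    a₀ ⊗ a₁ ⊕ a₁ ⊗ a₀ ⊕ X ⊗ (a₂ ⊗ a₂)
      ≈⟨ solve 3 (λ P w x → let a₀ = P :^ 2 ; a₁ = con (+ 3) :* P :* w ; a₂ = con (+ 9) :* w :^ 2 in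
           a₀ :* a₁ :+ a₁ :* a₀ :+ x :* (a₂ :* a₂) := con (+ 6) :* P :^ 3 :* w :+ con (+ 81) :* x :* w :^ 4) ≈-refl P E3³ X ⟩
    const (+ 6) ⊗ pow P 3 ⊗ E3³ ⊕ const (+ 81) ⊗ X ⊗ pow E3³ 4 ∎
    where
    A = assemble a₀ a₁ a₂

E1³⊗ζ : E1³ ⊗ ζ ≈ X ⊗ E9³
E1³⊗ζ = ≈-trans (solve 4 (λ t x v i → t :* (x :* v :* i) := t :* i :* (x :* v)) ≈-refl E1³ X E9³ E1⁻³)
  (≈-trans (⊛-congʳ {X ⊗ E9³} E1³-inverse) (⊛-identityˡ (X ⊗ E9³)))

Vκ⊗Vτ : V κ ⊗ V τ ≈ pow X 3 ⊗ pow E9³ 3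
Vκ⊗Vτ = ≈-trans (≈-sym (V-⊗ κ τ)) (≈-trans (V-cong κ⊗τ) (≈-trans (V-⊗ X (pow E3³ 3)) (⊛-cong V-X (V-pow E3³ 3))))

-- Multiplied by E₁⁹ this is P³(q³) − 27q³E₉⁹ = E₃¹²/E₉³ with P(q³) = E₁³ + 3qE₉³.
ζ-cubic : pow ζ 3 ≈ V τ ⊗ (one ⊕ const (+ 9) ⊗ ζ ⊕ const (+ 27) ⊗ pow ζ 2)
ζ-cubic = ⊗-cancel-unit {pow E1³ 3} {pow E1⁻³ 3} t³-inverse (begin
  pow t 3 ⊗ pow ζ 3
    ≈⟨ ≈-trans (≈-sym (pow-⊗ t ζ 3)) (≈-trans (pow-cong 3 E1³⊗ζ) (pow-⊗ X E9³ 3)) ⟩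
  pow X 3 ⊗ pow E9³ 3
    ≈⟨ Vκ⊗Vτ ⟨
  V κ ⊗ V τ
    ≈⟨ ⊛-congʳ {V τ} Vκ-expand ⟩
  (pow P₃ 3 ⊕ ⊝ (const (+ 27) ⊗ pow X 3 ⊗ pow E9³ 3)) ⊗ V τ
    -- With s = E₁³ + 3q E₉³ the multiplier is, up to sign, the cofactor of p - s in p³ - s³.
    ≈⟨ ⊛-congʳ {V τ} (lincomb₁ (⊝ (pow P₃ 2 ⊕ P₃ ⊗ (t ⊕ const (+ 3) ⊗ X ⊗ E9³) ⊕ pow (t ⊕ const (+ 3) ⊗ X ⊗ E9³) 2))
         {lhs = pow P₃ 3 ⊕ ⊝ (const (+ 27) ⊗ pow X 3 ⊗ pow E9³ 3)} {pow t 3 ⊕ const (+ 9) ⊗ pow t 2 ⊗ (X ⊗ E9³) ⊕ const (+ 27) ⊗ t ⊗ pow (X ⊗ E9³) 2} E1³-dissection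
         (solve 4 (λ t p x v → let s = t :+ con (+ 3) :* x :* v in
           p :^ 3 :- con (+ 27) :* x :^ 3 :* v :^ 3 :- (t :^ 3 :+ con (+ 9) :* t :^ 2 :* (x :* v) :+ con (+ 27) :* t :* (x :* v) :^ 2)
           := :- (p :^ 2 :+ p :* s :+ s :^ 2) :* (t :- (p :- con (+ 3) :* x :* v))) ≈-refl t P₃ X E9³)) ⟩
  (pow t 3 ⊕ const (+ 9) ⊗ pow t 2 ⊗ (X ⊗ E9³) ⊕ const (+ 27) ⊗ t ⊗ pow (X ⊗ E9³) 2) ⊗ V τ
    ≈⟨ ⊛-congʳ {V τ} (⊕-cong (⊕-congˡ {pow t 3} (⊛-congˡ {const (+ 9) ⊗ pow t 2} E1³⊗ζ)) (⊛-congˡ {const (+ 27) ⊗ t} (pow-cong 2 E1³⊗ζ))) ⟨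
  (pow t 3 ⊕ const (+ 9) ⊗ pow t 2 ⊗ (t ⊗ ζ) ⊕ const (+ 27) ⊗ t ⊗ pow (t ⊗ ζ) 2) ⊗ V τ
    ≈⟨ solve 3 (λ t ζ τ → (t :^ 3 :+ con (+ 9) :* t :^ 2 :* (t :* ζ) :+ con (+ 27) :* t :* (t :* ζ) :^ 2) :* τ
         := t :^ 3 :* (τ :* (t :^ 0 :+ con (+ 9) :* ζ :+ con (+ 27) :* ζ :^ 2))) ≈-refl t ζ (V τ) ⟩
  pow t 3 ⊗ (V τ ⊗ (one ⊕ const (+ 9) ⊗ ζ ⊕ const (+ 27) ⊗ pow ζ 2)) ∎)
  where
  open ≈-Reasoning
  t = E1³
  t³-inverse : pow E1⁻³ 3 ⊗ pow t 3 ≈ one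
  t³-inverse = ≈-trans (≈-sym (pow-⊗ E1⁻³ t 3)) (≈-trans (pow-cong 3 (≈-trans (⊛-comm E1⁻³ t) E1³-inverse)) (pow-one 3))

H-rec : ∀ i → H (3 ℕ.+ i) ≈ τ ⊗ (const (+ 27) ⊗ H (2 ℕ.+ i) ⊕ const (+ 9) ⊗ H (1 ℕ.+ i) ⊕ H i)
H-rec i = begin
  U 0 (pow ζ (3 ℕ.+ i))
    ≈⟨ U-cong 0 (≈-trans (pow-+ ζ 3 i) (≈-trans (⊛-congʳ {z} ζ-cubic)
         (solve 3 (λ τ ζ z → τ :* (ζ :^ 0 :+ con (+ 9) :* ζ :+ con (+ 27) :* ζ :^ 2) :* z
           := τ :* (con (+ 27) :* (ζ :* (ζ :* z)) :+ con (+ 9) :* (ζ :* z) :+ z)) ≈-refl (V τ) ζ z))) ⟩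
  U 0 (V τ ⊗ (const (+ 27) ⊗ (ζ ⊗ (ζ ⊗ z)) ⊕ const (+ 9) ⊗ (ζ ⊗ z) ⊕ z))
    ≈⟨ U0-V⊗ τ (const (+ 27) ⊗ (ζ ⊗ (ζ ⊗ z)) ⊕ const (+ 9) ⊗ (ζ ⊗ z) ⊕ z) ⟩
  τ ⊗ (U 0 (const (+ 27) ⊗ (ζ ⊗ (ζ ⊗ z))) ⊕ U 0 (const (+ 9) ⊗ (ζ ⊗ z)) ⊕ U 0 z)
    ≈⟨ ⊛-congˡ {τ} (⊕-congʳ {U 0 z} (⊕-cong (U0-const (+ 27) (ζ ⊗ (ζ ⊗ z))) (U0-const (+ 9) (ζ ⊗ z)))) ⟩
  τ ⊗ (const (+ 27) ⊗ H (2 ℕ.+ i) ⊕ const (+ 9) ⊗ H (1 ℕ.+ i) ⊕ H i) ∎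
  where
  open ≈-Reasoning
  z = pow ζ i
  U0-const : ∀ a f → U 0 (const a ⊗ f) ≈ const a ⊗ U 0 f
  U0-const a f = ≈-trans (U-cong 0 (⊛-congʳ {f} (≈-sym (V-const a)))) (U0-V⊗ (const a) f)

sumTo-head : ∀ N F → sumTo (suc N) F ≈ F 0 ⊕ sumTo N (λ k → F (suc k))
sumTo-head zero    F = solve 1 (λ a → con 0ℤ :+ a := a :+ con 0ℤ) ≈-refl (F 0)
sumTo-head (suc N) F = ≈-trans (⊕-congʳ {F (suc N)} (sumTo-head N F))
  (solve 3 (λ a b d → a :+ b :+ d := a :+ (b :+ d)) ≈-refl (F 0) (sumTo N (λ k → F (suc k))) (F (suc N)))

sumTo-⊕ : ∀ F G N → sumTo N (λ k → F k ⊕ G k) ≈ sumTo N F ⊕ sumTo N G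
sumTo-⊕ F G zero    = solve 0 (con 0ℤ := con 0ℤ :+ con 0ℤ) ≈-refl
sumTo-⊕ F G (suc N) = ≈-trans (⊕-congʳ {F N ⊕ G N} (sumTo-⊕ F G N))
  (solve 4 (λ a b d e → a :+ b :+ (d :+ e) := a :+ d :+ (b :+ e)) ≈-refl (sumTo N F) (sumTo N G) (F N) (G N))

⊗-sumTo : ∀ f F N → f ⊗ sumTo N F ≈ sumTo N (λ k → f ⊗ F k)
⊗-sumTo f F zero    = ⊛-zeroʳ f
⊗-sumTo f F (suc N) = ≈-trans (solve 3 (λ a b f → f :* (a :+ b) := f :* a :+ f :* b) ≈-refl (sumTo N F) (F N) f) (⊕-congʳ {f ⊗ F N} (⊗-sumTo f F N))

mm-rec : ∀ i j → mm (suc i) (2 ℕ.+ j) ≡ 27 ℕ.* mm i (suc j) ℕ.+ 9 ℕ.* mm (i ∸ 1) (suc j) ℕ.+ mm (i ∸ 2) (suc j)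
mm-rec zero                j = refl
mm-rec (suc zero)          j = refl
mm-rec (suc (suc zero))    j = refl
mm-rec (suc (suc (suc i))) j = refl

-- The generating polynomial in τ of row i over columns 1 to N. N stays a parameter because the
-- recurrence of m lowers row and column together.
mm-column : ℕ → ℕ → Series
mm-column N i = sumTo N (λ k → const (+ mm i (suc k)) ⊗ pow τ (suc k))

const-ℕ-+ : ∀ a b → const (+ (a ℕ.+ b)) ≈ const (+ a) ⊕ const (+ b)
const-ℕ-+ a b = pointwise λ { zero → refl ; (suc _) → refl }

const-⊗-const : ∀ a b → const (a ℤ.* b) ≈ const a ⊗ const b
const-⊗-const a b = pointwise λ n → trans (scaled n) (sym (at (const-⊛ a (const b)) n))
  where
  scaled : ∀ n → const (a ℤ.* b) n ≡ a ℤ.* const b n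
  scaled zero    = refl
  scaled (suc n) = sym (ℤ.*-zeroʳ a)

const-ℕ-* : ∀ a b → const (+ (a ℕ.* b)) ≈ const (+ a) ⊗ const (+ b)
const-ℕ-* a b = ≈-trans (reflexive (cong const (ℤ.pos-* a b))) (const-⊗-const (+ a) (+ b))

mm-column-rec : ∀ N i → mm-column (suc N) (suc i) ≈
  τ ⊗ (const (+ mm (suc i) 1) ⊕ (const (+ 27) ⊗ mm-column N i ⊕ const (+ 9) ⊗ mm-column N (i ∸ 1) ⊕ mm-column N (i ∸ 2)))
mm-column-rec N i = begin
  mm-column (suc N) (suc i)
    ≈⟨ sumTo-head N _ ⟩
  const (+ mm (suc i) 1) ⊗ (τ ⊗ one) ⊕ sumTo N (λ k → const (+ mm (suc i) (2 ℕ.+ k)) ⊗ (τ ⊗ pow τ (suc k)))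
    ≈⟨ ⊕-cong (solve 2 (λ a τ → a :* (τ :* τ :^ 0) := a :* τ) ≈-refl (const (+ mm (suc i) 1)) τ) (sumTo-cong N term) ⟩
  const (+ mm (suc i) 1) ⊗ τ ⊕ sumTo N (λ k → τ ⊗ (const (+ 27) ⊗ F i k ⊕ const (+ 9) ⊗ F (i ∸ 1) k ⊕ F (i ∸ 2) k))
    ≈⟨ ⊕-congˡ {const (+ mm (suc i) 1) ⊗ τ} (≈-sym (⊗-sumTo τ _ N)) ⟩
  const (+ mm (suc i) 1) ⊗ τ ⊕ τ ⊗ sumTo N (λ k → const (+ 27) ⊗ F i k ⊕ const (+ 9) ⊗ F (i ∸ 1) k ⊕ F (i ∸ 2) k)
    ≈⟨ ⊕-congˡ {const (+ mm (suc i) 1) ⊗ τ} (⊛-congˡ {τ} (≈-trans (sumTo-⊕ _ _ N) (⊕-congʳ {mm-column N (i ∸ 2)} (≈-trans (sumTo-⊕ _ _ N)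
         (⊕-cong (≈-sym (⊗-sumTo (const (+ 27)) _ N)) (≈-sym (⊗-sumTo (const (+ 9)) _ N))))))) ⟩
  const (+ mm (suc i) 1) ⊗ τ ⊕ τ ⊗ (const (+ 27) ⊗ mm-column N i ⊕ const (+ 9) ⊗ mm-column N (i ∸ 1) ⊕ mm-column N (i ∸ 2))
    ≈⟨ solve 3 (λ a τ b → a :* τ :+ τ :* b := τ :* (a :+ b)) ≈-refl (const (+ mm (suc i) 1)) τ
         (const (+ 27) ⊗ mm-column N i ⊕ const (+ 9) ⊗ mm-column N (i ∸ 1) ⊕ mm-column N (i ∸ 2)) ⟩
  _ ∎
  where
  open ≈-Reasoning
  F : ℕ → ℕ → Series
  F i k = const (+ mm i (suc k)) ⊗ pow τ (suc k)
  term : ∀ k → const (+ mm (suc i) (2 ℕ.+ k)) ⊗ (τ ⊗ pow τ (suc k)) ≈ τ ⊗ (const (+ 27) ⊗ F i k ⊕ const (+ 9) ⊗ F (i ∸ 1) k ⊕ F (i ∸ 2) k)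
  term k = ≈-trans (⊛-congʳ {τ ⊗ pow τ (suc k)} (≈-trans (reflexive (cong (λ z → const (+ z)) (mm-rec i k)))
      (≈-trans (const-ℕ-+ _ (mm (i ∸ 2) (suc k))) (⊕-congʳ {const (+ mm (i ∸ 2) (suc k))}
        (≈-trans (const-ℕ-+ (27 ℕ.* mm i (suc k)) (9 ℕ.* mm (i ∸ 1) (suc k))) (⊕-cong (const-ℕ-* 27 (mm i (suc k))) (const-ℕ-* 9 (mm (i ∸ 1) (suc k)))))))))
    (solve 5 (λ a b d τ u → (con (+ 27) :* a :+ con (+ 9) :* b :+ d) :* (τ :* u) := τ :* (con (+ 27) :* (a :* u) :+ con (+ 9) :* (b :* u) :+ d :* u))
      ≈-refl (const (+ mm i (suc k))) (const (+ mm (i ∸ 1) (suc k))) (const (+ mm (i ∸ 2) (suc k))) τ (pow τ (suc k)))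

mm-column-0 : ∀ N → mm-column N 0 ≈ const 0ℤ
mm-column-0 zero    = ≈-refl
mm-column-0 (suc N) = ≈-trans (⊕-cong (mm-column-0 N) (⊛-zeroˡ (pow τ (suc N)))) (solve 0 (con 0ℤ :+ con 0ℤ := con 0ℤ) ≈-refl)

mm-column-1 : ∀ N → mm-column (suc N) 1 ≈ const (+ 9) ⊗ τ
mm-column-1 N = ≈-trans (mm-column-rec N 0) (≈-trans (⊛-congˡ {τ} (⊕-congˡ {const (+ 9)} (⊕-cong (⊕-cong (⊛-congˡ {const (+ 27)} z) (⊛-congˡ {const (+ 9)} z)) z)))
  (solve 1 (λ τ → τ :* (con (+ 9) :+ (con (+ 27) :* con 0ℤ :+ con (+ 9) :* con 0ℤ :+ con 0ℤ)) := con (+ 9) :* τ) ≈-refl τ))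
  where z = mm-column-0 N

mm-column-2 : ∀ N → mm-column (2 ℕ.+ N) 2 ≈ const (+ 6) ⊗ τ ⊕ const (+ 243) ⊗ (τ ⊗ τ)
mm-column-2 N = ≈-trans (mm-column-rec (suc N) 1) (≈-trans (⊛-congˡ {τ} (⊕-congˡ {const (+ 6)} (⊕-cong (⊕-cong (⊛-congˡ {const (+ 27)} (mm-column-1 N)) (⊛-congˡ {const (+ 9)} z)) z)))
  (solve 1 (λ τ → τ :* (con (+ 6) :+ (con (+ 27) :* (con (+ 9) :* τ) :+ con (+ 9) :* con 0ℤ :+ con 0ℤ)) := con (+ 6) :* τ :+ con (+ 243) :* (τ :* τ)) ≈-refl τ))
  where z = mm-column-0 (suc N)

-- `H (suc i)` has degree at most i + 1 in τ, so N > i columns hold all of it. At row 3 the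
-- recurrence reaches `H 0`, which is 1, whereas row 0 of the matrix is 0; the entry m(3,1) = 1
-- makes up the difference.
H≈mm-column : ∀ i N → i < N → H (suc i) ≈ mm-column N (suc i)
H≈mm-column zero          (suc N)       _ = ≈-trans H-1 (≈-sym (mm-column-1 N))
H≈mm-column (suc zero)    (suc (suc N)) _ = ≈-trans H-2 (≈-sym (mm-column-2 N))
H≈mm-column (suc zero)    (suc zero) (s≤s ())
H≈mm-column (suc (suc zero)) (suc N) (s≤s 2≤N) = begin
  H 3
    ≈⟨ H-rec 0 ⟩
  τ ⊗ (const (+ 27) ⊗ H 2 ⊕ const (+ 9) ⊗ H 1 ⊕ H 0)
    ≈⟨ ⊛-congˡ {τ} (⊕-cong (⊕-cong (⊛-congˡ {const (+ 27)} (H≈mm-column 1 N 2≤N)) (⊛-congˡ {const (+ 9)} (H≈mm-column 0 N (ℕ.≤-trans (s≤s z≤n) 2≤N)))) H-0) ⟩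
  τ ⊗ (const (+ 27) ⊗ mm-column N 2 ⊕ const (+ 9) ⊗ mm-column N 1 ⊕ const 1ℤ)
    ≈⟨ ⊛-congˡ {τ} (solve 2 (λ a b → a :+ b :+ con 1ℤ := con 1ℤ :+ (a :+ b :+ con 0ℤ)) ≈-refl (const (+ 27) ⊗ mm-column N 2) (const (+ 9) ⊗ mm-column N 1)) ⟩
  τ ⊗ (const 1ℤ ⊕ (const (+ 27) ⊗ mm-column N 2 ⊕ const (+ 9) ⊗ mm-column N 1 ⊕ const 0ℤ))
    ≈⟨ ⊛-congˡ {τ} (⊕-congˡ {const 1ℤ} (⊕-congˡ {const (+ 27) ⊗ mm-column N 2 ⊕ const (+ 9) ⊗ mm-column N 1} (mm-column-0 N))) ⟨
  τ ⊗ (const 1ℤ ⊕ (const (+ 27) ⊗ mm-column N 2 ⊕ const (+ 9) ⊗ mm-column N 1 ⊕ mm-column N 0))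
    ≈⟨ mm-column-rec N 2 ⟨
  mm-column (suc N) 3 ∎
  where
  open ≈-Reasoning
  H-0 : H 0 ≈ const 1ℤ
  H-0 = ≈-trans (U-cong 0 (≈-sym V-one)) (≈-trans (U0-V one) one≈const1)
H≈mm-column (suc (suc (suc i))) (suc N) (s≤s i<N) = begin
  H (4 ℕ.+ i)
    ≈⟨ H-rec (suc i) ⟩
  τ ⊗ (const (+ 27) ⊗ H (3 ℕ.+ i) ⊕ const (+ 9) ⊗ H (2 ℕ.+ i) ⊕ H (1 ℕ.+ i))
    ≈⟨ ⊛-congˡ {τ} (⊕-cong (⊕-cong (⊛-congˡ {const (+ 27)} (H≈mm-column (suc (suc i)) N i<N))
         (⊛-congˡ {const (+ 9)} (H≈mm-column (suc i) N (ℕ.≤-trans (ℕ.n≤1+n _) i<N)))) (H≈mm-column i N (ℕ.≤-trans (ℕ.m≤n+m _ 2) i<N))) ⟩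
  τ ⊗ M
    ≈⟨ ⊛-congˡ {τ} (solve 1 (λ a → a := con 0ℤ :+ a) ≈-refl M) ⟩
  τ ⊗ (const 0ℤ ⊕ M)
    ≈⟨ mm-column-rec N (3 ℕ.+ i) ⟨
  mm-column (suc N) (4 ℕ.+ i) ∎
  where
  open ≈-Reasoning
  M = const (+ 27) ⊗ mm-column N (3 ℕ.+ i) ⊕ const (+ 9) ⊗ mm-column N (2 ℕ.+ i) ⊕ mm-column N (1 ℕ.+ i)

-- The matrix b and the main theorem

-- Column 1 is supported on rows 1 to 3, and each further column raises the last row by at most 3.
mm-vanishes : ∀ i j → 3 ℕ.* j < i → mm i j ≡ 0
mm-vanishes (suc i) zero          _ = refl
mm-vanishes (suc (suc (suc (suc i)))) (suc zero) _ = refl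
mm-vanishes (suc zero)             (suc zero) (s≤s ())
mm-vanishes (suc (suc zero))       (suc zero) (s≤s (s≤s ()))
mm-vanishes (suc (suc (suc zero))) (suc zero) (s≤s (s≤s (s≤s ())))
mm-vanishes (suc i) (suc (suc j)) h = trans (mm-rec i j) (cong₂ ℕ._+_ (cong₂ (λ a b → 27 ℕ.* a ℕ.+ 9 ℕ.* b)
    (mm-vanishes i (suc j) (bound 0 z≤n)) (mm-vanishes (i ∸ 1) (suc j) (bound 1 (s≤s z≤n)))) (mm-vanishes (i ∸ 2) (suc j) (bound 2 ℕ.≤-refl)))
  where
  bound : ∀ d → d ≤ 2 → 3 ℕ.* suc j < i ∸ d
  bound d d≤2 = ℕ.m+n≤o⇒m≤o∸n (suc (3 ℕ.* suc j)) (begin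
    suc (3 ℕ.* suc j) ℕ.+ d   ≤⟨ ℕ.+-monoʳ-≤ (suc (3 ℕ.* suc j)) d≤2 ⟩
    suc (3 ℕ.* suc j) ℕ.+ 2   ≡⟨ shift j ⟩
    3 ℕ.* suc (suc j)         ≤⟨ ℕ.≤-pred h ⟩
    i                         ∎)
    where
    open ℕ.≤-Reasoning
    shift : ∀ j → suc (3 ℕ.* suc j) ℕ.+ 2 ≡ 3 ℕ.* suc (suc j)
    shift = ℕ-solve-∀

-- The series factor of summand l = k + 1 of the right-hand side, in powers of E₃³ and E₁³: 12l - 3
-- = 3(3 + 4k) and 12l + 3 = 3(5 + 4k).
term : ℕ → Series
term k = pow X k ⊗ (pow E3³ (3 ℕ.+ 4 ℕ.* k) ⊗ pow E1⁻³ (5 ℕ.+ 4 ℕ.* k))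

term-vanishes : ∀ k f → f ⊗ term k ≈[ k ] const 0ℤ
term-vanishes k f = ≈[]-trans (⊗-cong[] {f = f} ≈[]-refl (Xpow-vanishes k k (pow E3³ (3 ℕ.+ 4 ℕ.* k) ⊗ pow E1⁻³ (5 ℕ.+ 4 ℕ.* k)) ℕ.≤-refl)) (truncate (⊛-zeroʳ f))

sumTo-truncate : ∀ {F : ℕ → Series} → (∀ k → F k ≈[ k ] const 0ℤ) → ∀ d N → sumTo (d ℕ.+ N) F ≈[ N ] sumTo N F
sumTo-truncate h zero    N = ≈[]-refl
sumTo-truncate {F} h (suc d) N = ≈[]-trans (⊕-cong[] (sumTo-truncate {F} h d N) (weaken (ℕ.m≤n+m N d) (h (d ℕ.+ N))))
  (truncate (solve 1 (λ a → a :+ con 0ℤ := a) ≈-refl (sumTo N F)))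

sumTo-zero : ∀ {F : ℕ → Series} N → (∀ k → k < N → F k ≈ const 0ℤ) → sumTo N F ≈ const 0ℤ
sumTo-zero zero    h = ≈-refl
sumTo-zero (suc N) h = ≈-trans (⊕-cong (sumTo-zero N (λ k k<N → h k (ℕ.m<n⇒m<1+n k<N))) (h N ℕ.≤-refl))
  (solve 0 (con 0ℤ :+ con 0ℤ := con 0ℤ) ≈-refl)

sumTo-+ : ∀ F M N → sumTo (N ℕ.+ M) F ≈ sumTo M F ⊕ sumTo N (λ k → F (k ℕ.+ M))
sumTo-+ F M zero    = solve 1 (λ a → a := a :+ con 0ℤ) ≈-refl (sumTo M F)
sumTo-+ F M (suc N) = ≈-trans (⊕-congʳ {F (N ℕ.+ M)} (sumTo-+ F M N))
  (solve 3 (λ a b d → a :+ b :+ d := a :+ (b :+ d)) ≈-refl (sumTo M F) (sumTo N (λ k → F (k ℕ.+ M))) (F (N ℕ.+ M)))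

τ-pow : ∀ m → pow τ m ≈ pow X m ⊗ pow E3³ (m ℕ.* 4) ⊗ pow E1⁻³ (m ℕ.* 4)
τ-pow m = ≈-trans (pow-⊗ (X ⊗ pow E3³ 4) (pow E1⁻³ 4) m) (⊛-cong (≈-trans (pow-⊗ X (pow E3³ 4) m) (⊛-congˡ {pow X m} (≈-sym (pow-* E3³ m 4))))
  (≈-sym (pow-* E1⁻³ m 4)))

-- The factor q^(l+2) E₃^(15+12l) is the one in `H-term`; cancelling it turns a polynomial in τ into
-- a combination of terms.
τ-pow-term : ∀ l k → pow E1³ (3 ℕ.+ 4 ℕ.* l) ⊗ pow τ (suc (k ℕ.+ suc l)) ≈ pow X (2 ℕ.+ l) ⊗ (pow E3³ (5 ℕ.+ 4 ℕ.* l) ⊗ term k)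
τ-pow-term l k = begin
  tᵇ ⊗ pow τ m
    ≈⟨ ⊛-congˡ {tᵇ} (τ-pow m) ⟩
  tᵇ ⊗ (pow X m ⊗ pow E3³ (m ℕ.* 4) ⊗ pow E1⁻³ (m ℕ.* 4))
    ≈⟨ ⊛-congˡ {tᵇ} (⊛-cong (⊛-cong (≈-trans (reflexive (cong (pow X) (X-exponent l k))) (pow-+ X (2 ℕ.+ l) k))
         (≈-trans (reflexive (cong (pow E3³) (E3-exponent l k))) (pow-+ E3³ (5 ℕ.+ 4 ℕ.* l) (3 ℕ.+ 4 ℕ.* k))))
         (≈-trans (reflexive (cong (pow E1⁻³) (E1-exponent l k))) (pow-+ E1⁻³ (3 ℕ.+ 4 ℕ.* l) (5 ℕ.+ 4 ℕ.* k)))) ⟩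
  tᵇ ⊗ (pow X (2 ℕ.+ l) ⊗ pow X k ⊗ (wᵃ ⊗ pow E3³ (3 ℕ.+ 4 ℕ.* k)) ⊗ (iᵇ ⊗ pow E1⁻³ (5 ℕ.+ 4 ℕ.* k)))
    ≈⟨ solve 7 (λ t x y w w′ i i′ → t :* (x :* y :* (w :* w′) :* (i :* i′)) := t :* i :* (x :* (w :* (y :* (w′ :* i′))))) ≈-refl
         tᵇ (pow X (2 ℕ.+ l)) (pow X k) wᵃ (pow E3³ (3 ℕ.+ 4 ℕ.* k)) iᵇ (pow E1⁻³ (5 ℕ.+ 4 ℕ.* k)) ⟩
  tᵇ ⊗ iᵇ ⊗ (pow X (2 ℕ.+ l) ⊗ (wᵃ ⊗ term k))
    ≈⟨ ⊛-congʳ {pow X (2 ℕ.+ l) ⊗ (wᵃ ⊗ term k)} (≈-trans (≈-sym (pow-⊗ E1³ E1⁻³ (3 ℕ.+ 4 ℕ.* l))) (≈-trans (pow-cong (3 ℕ.+ 4 ℕ.* l) E1³-inverse) (pow-one (3 ℕ.+ 4 ℕ.* l)))) ⟩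
  one ⊗ (pow X (2 ℕ.+ l) ⊗ (wᵃ ⊗ term k))
    ≈⟨ ⊛-identityˡ _ ⟩
  pow X (2 ℕ.+ l) ⊗ (wᵃ ⊗ term k) ∎
  where
  open ≈-Reasoning
  m = suc (k ℕ.+ suc l)
  tᵇ = pow E1³ (3 ℕ.+ 4 ℕ.* l)
  iᵇ = pow E1⁻³ (3 ℕ.+ 4 ℕ.* l)
  wᵃ = pow E3³ (5 ℕ.+ 4 ℕ.* l)
  X-exponent : ∀ l k → suc (k ℕ.+ suc l) ≡ 2 ℕ.+ l ℕ.+ k
  X-exponent = ℕ-solve-∀
  E3-exponent : ∀ l k → suc (k ℕ.+ suc l) ℕ.* 4 ≡ 5 ℕ.+ 4 ℕ.* l ℕ.+ (3 ℕ.+ 4 ℕ.* k)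
  E3-exponent = ℕ-solve-∀
  E1-exponent : ∀ l k → suc (k ℕ.+ suc l) ℕ.* 4 ≡ 3 ℕ.+ 4 ℕ.* l ℕ.+ (5 ℕ.+ 4 ℕ.* k)
  E1-exponent = ℕ-solve-∀

-- Since 5 + 4l = 3(1 + l) + (2 + l), both this power of ζ and q² · `term l` are q^(2+l) /
-- E₁^(15+12l) up to factors in q³. As U₀(q² f) = q U₁(f), the section `U 0` of the power becomes
-- `U 1` of the term.
H-term : ∀ l → pow E1³ (3 ℕ.+ 4 ℕ.* l) ⊗ H (5 ℕ.+ 4 ℕ.* l) ≈ pow X (2 ℕ.+ l) ⊗ (pow E3³ (5 ℕ.+ 4 ℕ.* l) ⊗ U 1 (term l))
H-term l = begin
  tᵇ ⊗ U 0 (pow ζ a)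
    ≈⟨ ⊛-congˡ {tᵇ} (U-cong 0 ζ-pow) ⟩
  tᵇ ⊗ U 0 (V (pow X (1 ℕ.+ l) ⊗ wᵃ) ⊗ (X ⊗ (X ⊗ g)))
    ≈⟨ ⊛-congˡ {tᵇ} (≈-trans (U0-V⊗ (pow X (1 ℕ.+ l) ⊗ wᵃ) (X ⊗ (X ⊗ g))) (⊛-congˡ {pow X (1 ℕ.+ l) ⊗ wᵃ} (≈-trans (U0-X⊗ (X ⊗ g)) (⊛-congˡ {X} (U2-X⊗ g))))) ⟩
  tᵇ ⊗ (pow X (1 ℕ.+ l) ⊗ wᵃ ⊗ (X ⊗ U 1 g))
    ≈⟨ solve 5 (λ t x y w u → t :* (y :* w :* (x :* u)) := x :* y :* (w :* (t :* u))) ≈-refl tᵇ X (pow X (1 ℕ.+ l)) wᵃ (U 1 g) ⟩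
  pow X (2 ℕ.+ l) ⊗ (wᵃ ⊗ (tᵇ ⊗ U 1 g))
    ≈⟨ ⊛-congˡ {pow X (2 ℕ.+ l)} (⊛-congˡ {wᵃ} (U1-V⊗ tᵇ g)) ⟨
  pow X (2 ℕ.+ l) ⊗ (wᵃ ⊗ U 1 (V tᵇ ⊗ g))
    ≈⟨ ⊛-congˡ {pow X (2 ℕ.+ l)} (⊛-congˡ {wᵃ} (U-cong 1 (≈-trans (⊛-congʳ {g} (V-pow E1³ (3 ℕ.+ 4 ℕ.* l)))
         (solve 3 (λ a b d → a :* (b :* d) := b :* (a :* d)) ≈-refl (pow E3³ (3 ℕ.+ 4 ℕ.* l)) (pow X l) (pow E1⁻³ a))))) ⟩
  pow X (2 ℕ.+ l) ⊗ (wᵃ ⊗ U 1 (term l)) ∎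
  where
  open ≈-Reasoning
  a = 5 ℕ.+ 4 ℕ.* l
  tᵇ = pow E1³ (3 ℕ.+ 4 ℕ.* l)
  wᵃ = pow E3³ a
  g = pow X l ⊗ pow E1⁻³ a
  exponent : ∀ l → 5 ℕ.+ 4 ℕ.* l ≡ 3 ℕ.* (1 ℕ.+ l) ℕ.+ (2 ℕ.+ l)
  exponent = ℕ-solve-∀
  ζ-pow : pow ζ a ≈ V (pow X (1 ℕ.+ l) ⊗ wᵃ) ⊗ (X ⊗ (X ⊗ g))
  ζ-pow = begin
    pow ζ a                                                                     ≈⟨ ≈-trans (pow-⊗ (X ⊗ E9³) E1⁻³ a) (⊛-congʳ {pow E1⁻³ a} (pow-⊗ X E9³ a)) ⟩
    pow X a ⊗ pow E9³ a ⊗ pow E1⁻³ a                                              ≈⟨ ⊛-congʳ {pow E1⁻³ a} (⊛-cong (≈-trans (reflexive (cong (pow X) (exponent l)))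
                                                                                     (≈-trans (pow-+ X (3 ℕ.* (1 ℕ.+ l)) (2 ℕ.+ l)) (⊛-congʳ {pow X (2 ℕ.+ l)} (≈-sym (V-Xpow (1 ℕ.+ l))))))
                                                                                     (≈-sym (V-pow E3³ a))) ⟩
    V (pow X (1 ℕ.+ l)) ⊗ (X ⊗ (X ⊗ pow X l)) ⊗ V wᵃ ⊗ pow E1⁻³ a               ≈⟨ solve 5 (λ y x z w i → y :* (x :* (x :* z)) :* w :* i := y :* w :* (x :* (x :* (z :* i)))) ≈-refl
                                                                                     (V (pow X (1 ℕ.+ l))) X (pow X l) (V wᵃ) (pow E1⁻³ a) ⟩
    V (pow X (1 ℕ.+ l)) ⊗ V wᵃ ⊗ (X ⊗ (X ⊗ g))                                  ≈⟨ ⊛-congʳ {X ⊗ (X ⊗ g)} (V-⊗ (pow X (1 ℕ.+ l)) wᵃ) ⟨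
    V (pow X (1 ℕ.+ l) ⊗ wᵃ) ⊗ (X ⊗ (X ⊗ g))                                    ∎

U1-term : ∀ l N → U 1 (term l) ≈[ N ] sumTo N (λ k → const (+ mm (4 ℕ.* suc l ℕ.+ 1) (suc l ℕ.+ suc k)) ⊗ term k)
U1-term l N = ≈[]-trans (truncate exact) (≈[]-trans (sumTo-truncate (λ k → term-vanishes k (const (+ mm a (suc (k ℕ.+ suc l))))) a N)
  (truncate (sumTo-cong N λ k → ⊛-congʳ {term k} (reflexive (cong₂ (λ i j → const (+ mm i j)) (row l) (column l k))))))
  where
  open ≈-Reasoning
  a = 5 ℕ.+ 4 ℕ.* l
  -- The summand a covers the degree of `H a` in τ, and N the precision.
  K = a ℕ.+ N
  tᵇ = pow E1³ (3 ℕ.+ 4 ℕ.* l)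
  wᵃ = pow E3³ a
  row : ∀ l → 5 ℕ.+ 4 ℕ.* l ≡ 4 ℕ.* suc l ℕ.+ 1
  row = ℕ-solve-∀
  column : ∀ l k → suc (k ℕ.+ suc l) ≡ suc l ℕ.+ suc k
  column = ℕ-solve-∀
  F : ℕ → Series
  F k = const (+ mm a (suc k)) ⊗ pow τ (suc k)
  -- Columns up to l + 1 are empty because 3(l + 1) < 4l + 5. Hence `H a` is divisible by τ^(l+2),
  -- which allows q^(l+2) to be cancelled.
  low : ∀ k → k < suc l → F k ≈ const 0ℤ
  low k k≤l = ≈-trans (⊛-congʳ {pow τ (suc k)} (reflexive (cong (λ z → const (+ z)) (mm-vanishes a (suc k)
      (ℕ.≤-trans (s≤s (ℕ.*-monoʳ-≤ 3 k≤l)) (ℕ.≤-trans (ℕ.≤-reflexive (cong suc (ℕ.*-suc 3 l))) (ℕ.+-mono-≤ {4} {5} (ℕ.n≤1+n 4) (ℕ.*-monoˡ-≤ l (ℕ.n≤1+n 3)))))))))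
    (⊛-zeroˡ (pow τ (suc k)))
  bound : 4 ℕ.+ 4 ℕ.* l < K ℕ.+ suc l
  bound = ℕ.≤-trans (ℕ.m≤m+n a N) (ℕ.m≤m+n K (suc l))
  exact : U 1 (term l) ≈ sumTo K (λ k → const (+ mm a (suc (k ℕ.+ suc l))) ⊗ term k)
  exact = ⊗-cancel-unit {wᵃ} {pow E3⁻³ a} (≈-trans (≈-sym (pow-⊗ E3⁻³ E3³ a)) (≈-trans (pow-cong a (≈-trans (⊛-comm E3⁻³ E3³) E3³-inverse)) (pow-one a)))
    (Xpow-cancel (2 ℕ.+ l) (begin
      pow X (2 ℕ.+ l) ⊗ (wᵃ ⊗ U 1 (term l))                        ≈⟨ H-term l ⟨
      tᵇ ⊗ H a                                                     ≈⟨ ⊛-congˡ {tᵇ} (H≈mm-column (4 ℕ.+ 4 ℕ.* l) (K ℕ.+ suc l) bound) ⟩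
      tᵇ ⊗ sumTo (K ℕ.+ suc l) F                                   ≈⟨ ⊛-congˡ {tᵇ} (≈-trans (sumTo-+ F (suc l) K) (⊕-congʳ {sumTo K (λ k → F (k ℕ.+ suc l))} (sumTo-zero (suc l) low))) ⟩
      tᵇ ⊗ (const 0ℤ ⊕ sumTo K (λ k → F (k ℕ.+ suc l)))            ≈⟨ ⊛-congˡ {tᵇ} (solve 1 (λ b → con 0ℤ :+ b := b) ≈-refl (sumTo K (λ k → F (k ℕ.+ suc l)))) ⟩
      tᵇ ⊗ sumTo K (λ k → F (k ℕ.+ suc l))                         ≈⟨ ⊗-sumTo tᵇ (λ k → F (k ℕ.+ suc l)) K ⟩
      sumTo K (λ k → tᵇ ⊗ F (k ℕ.+ suc l))                         ≈⟨ sumTo-cong K (λ k → ≈-trans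
                                                                       (solve 3 (λ t m y → t :* (m :* y) := m :* (t :* y)) ≈-refl tᵇ (const (+ mm a (suc (k ℕ.+ suc l)))) (pow τ (suc (k ℕ.+ suc l))))
                                                                       (≈-trans (⊛-congˡ {const (+ mm a (suc (k ℕ.+ suc l)))} (τ-pow-term l k))
                                                                       (solve 4 (λ m x w y → m :* (x :* (w :* y)) := x :* w :* (m :* y)) ≈-refl (const (+ mm a (suc (k ℕ.+ suc l)))) (pow X (2 ℕ.+ l)) wᵃ (term k)))) ⟩
      sumTo K (λ k → pow X (2 ℕ.+ l) ⊗ wᵃ ⊗ M k)                   ≈⟨ ⊗-sumTo (pow X (2 ℕ.+ l) ⊗ wᵃ) M K ⟨
      pow X (2 ℕ.+ l) ⊗ wᵃ ⊗ sumTo K M                             ≈⟨ ⊛-assoc (pow X (2 ℕ.+ l)) wᵃ (sumTo K M) ⟩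
      pow X (2 ℕ.+ l) ⊗ (wᵃ ⊗ sumTo K M)                           ∎))
    where
    M : ℕ → Series
    M k = const (+ mm a (suc (k ℕ.+ suc l))) ⊗ term k

term-frozen : ∀ k → pow X k ⊗ (pow (E 3) (12 ℕ.* suc k ∸ 3) ⊗ pow (Einv 1) (12 ℕ.* suc k ℕ.+ 3)) ≈ term k
term-frozen k = ⊛-congˡ {pow X k} (⊛-cong
  (≈-trans (reflexive (cong (pow (E 3)) (trans (cong (_∸ 3) (E3-exponent k)) (ℕ.m+n∸n≡m ((3 ℕ.+ 4 ℕ.* k) ℕ.* 3) 3))))
    (≈-trans (pow-* (E 3) (3 ℕ.+ 4 ℕ.* k) 3) (pow-cong (3 ℕ.+ 4 ℕ.* k) (≈-trans (pow-cong 3 (≈-sym V-E1)) (≈-sym (V-pow (E 1) 3))))))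
  (≈-trans (reflexive (cong (pow (Einv 1)) (E1-exponent k))) (pow-* (Einv 1) (5 ℕ.+ 4 ℕ.* k) 3)))
  where
  E3-exponent : ∀ k → 12 ℕ.* suc k ≡ (3 ℕ.+ 4 ℕ.* k) ℕ.* 3 ℕ.+ 3
  E3-exponent = ℕ-solve-∀
  E1-exponent : ∀ k → 12 ℕ.* suc k ℕ.+ 3 ≡ (5 ℕ.+ 4 ℕ.* k) ℕ.* 3
  E1-exponent = ℕ-solve-∀

Σ1-sumTo : ∀ {f : ℕ → ℤ} {F : ℕ → Series} n → (∀ k → f (suc k) ≡ F k n) → ∀ N → Σ1 N f ≡ sumTo N F n
Σ1-sumTo zero    h zero = refl
Σ1-sumTo (suc n) h zero = refl
Σ1-sumTo n h (suc N) = cong₂ ℤ._+_ (Σ1-sumTo n h N) (h N)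

rhs-truncated : ∀ j N → rhs j ≈[ N ] sumTo N (λ k → const (+ bb j (suc k)) ⊗ term k)
rhs-truncated j N = below λ n n<N → trans (Σ1-sumTo n (coefficient n) (suc n))
  (trans (sym (at< (sumTo-truncate (λ k → term-vanishes k (const (+ bb j (suc k)))) (N ∸ suc n) (suc n)) n ℕ.≤-refl))
    (cong (λ M → sumTo M F n) (ℕ.m∸n+n≡m n<N)))
  where
  F : ℕ → Series
  F k = const (+ bb j (suc k)) ⊗ term k
  coefficient : ∀ n k → (+ bb j (suc k)) ℤ.* shiftQ k (pow (E 3) (12 ℕ.* suc k ∸ 3) ⊛ pow (Einv 1) (12 ℕ.* suc k ℕ.+ 3)) n ≡ F k n
  coefficient n k = trans (cong ((+ bb j (suc k)) ℤ.*_) (trans (sym (Xpow-⊗ k (pow (E 3) (12 ℕ.* suc k ∸ 3) ⊗ pow (Einv 1) (12 ℕ.* suc k ℕ.+ 3)) n)) (at (term-frozen k) n)))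
    (sym (at (const-⊛ (+ bb j (suc k)) (term k)) n))

sumTo-swap : ∀ (F : ℕ → ℕ → Series) L N → sumTo L (λ l → sumTo N (F l)) ≈ sumTo N (λ k → sumTo L (λ l → F l k))
sumTo-swap F zero    N = ≈-sym (sumTo-zero N (λ _ _ → ≈-refl))
sumTo-swap F (suc L) N = ≈-trans (⊕-congʳ {sumTo N (F L)} (sumTo-swap F L N)) (≈-sym (sumTo-⊕ (λ k → sumTo L (λ l → F l k)) (F L) N))

sumTo-cong< : ∀ {F G : ℕ → Series} N → (∀ k → k < N → F k ≈ G k) → sumTo N F ≈ sumTo N G
sumTo-cong< zero    h = ≈-refl
sumTo-cong< (suc N) h = ⊕-cong (sumTo-cong< N (λ k k<N → h k (ℕ.m<n⇒m<1+n k<N))) (h N ℕ.≤-refl)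

const-Σ1ℕ : ∀ (f g : ℕ → ℕ) L → sumTo L (λ l → const (+ f (suc l)) ⊗ const (+ g (suc l))) ≈ const (+ Σ1ℕ L (λ i → f i ℕ.* g i))
const-Σ1ℕ f g zero    = ≈-refl
const-Σ1ℕ f g (suc L) = ≈-trans (⊕-cong (const-Σ1ℕ f g L) (≈-sym (const-ℕ-* (f (suc L)) (g (suc L))))) (≈-sym (const-ℕ-+ _ (f (suc L) ℕ.* g (suc L))))

Σ1ℕ-extend : ∀ (f : ℕ → ℕ) L → (∀ i → L < i → f i ≡ 0) → ∀ d → Σ1ℕ (d ℕ.+ L) f ≡ Σ1ℕ L f
Σ1ℕ-extend f L h zero    = refl
Σ1ℕ-extend f L h (suc d) = trans (cong₂ ℕ._+_ (Σ1ℕ-extend f L h d) (h (suc (d ℕ.+ L)) (s≤s (ℕ.m≤n+m L d)))) (ℕ.+-identityʳ _)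

-- Lengthening the defining sum is harmless: for i > 3(k+1) one has 3(i + k + 1) < 4i + 1, so the
-- entry of m is 0.
bb-suc : ∀ j k N → k < N → Σ1ℕ (N ℕ.* 3) (λ i → bb (suc j) i ℕ.* mm (4 ℕ.* i ℕ.+ 1) (i ℕ.+ suc k)) ≡ bb (2 ℕ.+ j) (suc k)
bb-suc j k N k<N = trans (cong (λ L → Σ1ℕ L f) (sym (ℕ.m∸n+n≡m {N ℕ.* 3} (subst (3 ℕ.* suc k ≤_) (ℕ.*-comm 3 N) (ℕ.*-monoʳ-≤ 3 k<N)))))
  (Σ1ℕ-extend f (3 ℕ.* suc k) vanish (N ℕ.* 3 ∸ 3 ℕ.* suc k))
  where
  f : ℕ → ℕ
  f i = bb (suc j) i ℕ.* mm (4 ℕ.* i ℕ.+ 1) (i ℕ.+ suc k)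
  vanish : ∀ i → 3 ℕ.* suc k < i → f i ≡ 0
  vanish i h = trans (cong (bb (suc j) i ℕ.*_) (mm-vanishes (4 ℕ.* i ℕ.+ 1) (i ℕ.+ suc k) (begin-strict
    3 ℕ.* (i ℕ.+ suc k)         ≡⟨ ℕ.*-distribˡ-+ 3 i (suc k) ⟩
    3 ℕ.* i ℕ.+ 3 ℕ.* suc k     <⟨ ℕ.+-monoʳ-< (3 ℕ.* i) h ⟩
    3 ℕ.* i ℕ.+ i               ≡⟨ ℕ.+-comm (3 ℕ.* i) i ⟩
    4 ℕ.* i                     ≤⟨ ℕ.m≤m+n (4 ℕ.* i) 1 ⟩
    4 ℕ.* i ℕ.+ 1               ∎))) (ℕ.*-zeroʳ (bb (suc j) i))
    where open ℕ.≤-Reasoning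

U-sumTo : ∀ r F N → U r (sumTo N F) ≈ sumTo N (λ k → U r (F k))
U-sumTo zero    F zero    = ≈-trans (U-cong 0 (≈-sym (V-const 0ℤ))) (U0-V (const 0ℤ))
U-sumTo (suc r) F zero    = pointwise λ { zero → refl ; (suc n) → refl }
U-sumTo r       F (suc N) = ⊕-congʳ {U r (F N)} (U-sumTo r F N)

U1-const : ∀ a f → U 1 (const a ⊗ f) ≈ const a ⊗ U 1 f
U1-const a f = ≈-trans (U-cong 1 (⊛-congʳ {f} (≈-sym (V-const a)))) (U1-V⊗ (const a) f)

U1-rhs : ∀ j → U 1 (rhs (suc j)) ≈ rhs (2 ℕ.+ j)
-- L = 3N is both the precision that `U 1` consumes and a range long enough for `bb-suc` at every k
-- < N.
U1-rhs j = ≈[]-all λ N → let open ≈[]-Reasoning N ; L = N ℕ.* 3 in begin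
  U 1 (rhs (suc j))
    ≈⟨ U-cong[] {N} 1 (s≤s (s≤s z≤n)) (rhs-truncated (suc j) L) ⟩
  U 1 (sumTo L (λ l → b l ⊗ term l))
    ≈⟨ truncate (≈-trans (U-sumTo 1 _ L) (sumTo-cong L (λ l → U1-const (+ bb (suc j) (suc l)) (term l)))) ⟩
  sumTo L (λ l → b l ⊗ U 1 (term l))
    ≈⟨ sumTo-cong[] L (λ l → ⊗-cong[] {f = b l} ≈[]-refl (U1-term l N)) ⟩
  sumTo L (λ l → b l ⊗ sumTo N (λ k → m l k ⊗ term k))
    ≈⟨ truncate (≈-trans (sumTo-cong L (λ l → ≈-trans (⊗-sumTo (b l) _ N) (sumTo-cong N (λ k → ≈-sym (⊛-assoc (b l) (m l k) (term k))))))
         (sumTo-swap (λ l k → b l ⊗ m l k ⊗ term k) L N)) ⟩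
  sumTo N (λ k → sumTo L (λ l → b l ⊗ m l k ⊗ term k))
    ≈⟨ truncate (sumTo-cong< N λ k k<N → ≈-trans (≈-sym (sumTo-⊗ (term k) (λ l → b l ⊗ m l k) L)) (⊛-congʳ {term k}
         (≈-trans (const-Σ1ℕ (bb (suc j)) (λ i → mm (4 ℕ.* i ℕ.+ 1) (i ℕ.+ suc k)) L) (reflexive (cong (λ z → const (+ z)) (bb-suc j k N k<N)))))) ⟩
  sumTo N (λ k → const (+ bb (2 ℕ.+ j) (suc k)) ⊗ term k)
    ≈⟨ rhs-truncated (2 ℕ.+ j) N ⟨
  rhs (2 ℕ.+ j) ∎
  where
  b : ℕ → Series
  b l = const (+ bb (suc j) (suc l))
  m : ℕ → ℕ → Series
  m l k = const (+ mm (4 ℕ.* suc l ℕ.+ 1) (suc l ℕ.+ suc k))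

-- E₃⁻³ leaves `U 2` as E₁⁻³, and `U 2` of E₁⁻³ is 9E₃⁶/κ = 9E₃⁹/E₁¹²; so b(1,1) = 9 is the only
-- entry of the first row.
U2-p33 : U 2 p33 ≈ rhs 1
U2-p33 = begin
  U 2 (E1⁻³ ⊗ pow (Einv 3) 3)
    ≈⟨ U-cong 2 (≈-trans (⊛-comm E1⁻³ (pow (Einv 3) 3)) (⊛-congʳ {E1⁻³} (≈-trans (pow-cong 3 (≈-sym V-Einv1)) (≈-sym (V-pow (Einv 1) 3))))) ⟩
  U 2 (E3⁻³ ⊗ E1⁻³)
    ≈⟨ U2-V⊗ E1⁻³ E1⁻³ ⟩
  E1⁻³ ⊗ U 2 E1⁻³
    ≈⟨ lincomb₂ (⊝ (E1⁻³ ⊗ U 2 E1⁻³)) (E1⁻³ ⊗ E3³ ⊗ pow E1⁻³ 4) κ-inverse κ⊗U2-E1⁻³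
         (solve 4 (λ i u w c → i :* u :- con (+ 9) :* (i :^ 0 :* (w :^ 3 :* i :^ 5))
           := :- (i :* u) :* (w :* i :^ 4 :* c :- i :^ 0) :+ i :* w :* i :^ 4 :* (c :* u :- con (+ 9) :* w :^ 2)) ≈-refl E1⁻³ (U 2 E1⁻³) E3³ κ) ⟩
  const (+ 9) ⊗ term 0
    ≈⟨ first-row ⟨
  rhs 1 ∎
  where
  open ≈-Reasoning
  F : ℕ → Series
  F k = const (+ bb 1 (suc k)) ⊗ term k
  only-first : ∀ N → sumTo (suc N) F ≈ const (+ 9) ⊗ term 0
  only-first zero    = solve 1 (λ a → con 0ℤ :+ a := a) ≈-refl (const (+ 9) ⊗ term 0)
  only-first (suc N) = ≈-trans (⊕-cong (only-first N) (⊛-zeroˡ (term (suc N)))) (solve 1 (λ a → a :+ con 0ℤ := a) ≈-refl (const (+ 9) ⊗ term 0))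
  first-row : rhs 1 ≈ const (+ 9) ⊗ term 0
  first-row = ≈[]-all λ N → weaken (ℕ.n≤1+n N) (≈[]-trans (rhs-truncated 1 (suc N)) (truncate (only-first N)))

-- The number (3^(j+1) + 1)/2, built from its increments to avoid division.
offset : ℕ → ℕ
offset zero    = 2
offset (suc j) = 3 ℕ.^ suc j ℕ.+ offset j

offset-formula : ∀ j → (3 ℕ.^ suc j ℕ.+ 1) ℕ./ 2 ≡ offset j
offset-formula j = trans (cong (ℕ._/ 2) (double j)) (m*n/n≡m (offset j) 2)
  where
  step : ∀ a b → 3 ℕ.* a ℕ.+ 1 ≡ a ℕ.* 2 ℕ.+ (a ℕ.+ 1)
  step = ℕ-solve-∀
  double : ∀ j → 3 ℕ.^ suc j ℕ.+ 1 ≡ offset j ℕ.* 2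
  double zero    = refl
  double (suc j) = trans (step (3 ℕ.^ suc j) 0) (trans (cong (3 ℕ.^ suc j ℕ.* 2 ℕ.+_) (double j)) (sym (ℕ.*-distribʳ-+ 2 (3 ℕ.^ suc j) (offset j))))

-- The index for j + 1 at n equals the index for j at 3n + 1, so each step is one application of
-- `U 1`.
p33-progression : ∀ j n → p33 (3 ℕ.^ suc j ℕ.* n ℕ.+ offset j) ≡ rhs (suc j) n
p33-progression zero    n = trans (cong p33 (trans (ℕ.+-comm (3 ℕ.* n) 2) (cong (2 ℕ.+_) (ℕ.*-comm 3 n)))) (at U2-p33 n)
p33-progression (suc j) n = trans (cong p33 (index (3 ℕ.^ suc j) n (offset j))) (trans (p33-progression j (1 ℕ.+ n ℕ.* 3)) (at (U1-rhs j) n))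
  where
  index : ∀ a n o → 3 ℕ.* a ℕ.* n ℕ.+ (a ℕ.+ o) ≡ a ℕ.* (1 ℕ.+ n ℕ.* 3) ℕ.+ o
  index = ℕ-solve-∀

theorem3p5 : (j : ℕ) → 1 ≤ j → (n : ℕ) →
    p33 (3 ^ j * n + (3 ^ j + 1) / 2) ≡ rhs j n
theorem3p5 (suc j) _ n = trans (cong (λ o → p33 (3 ^ suc j * n + o)) (offset-formula j)) (p33-progression j n)
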